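{- Let $N$ be a net, let $\sigma,\rho\in \mathrm{FS}^\infty(N)$ and let $P,Q$ be GR-processes of $N$ such that $\sigma\in\mathrm{Lin}(P)$ and $\rho\in\mathrm{Lin}(Q)$. Then $\sigma\sqsubseteq_0^\infty\rho$ if and only if $P\sqsubseteq_1^\infty Q$.
   Context: Multisets over a set $X$ are functions $X\to\mathbb{N}$; $A\subseteq B$ means $A(x)\le B(x)$ for all $x$; $+$ and $-$ are pointwise, with $(A-B)(x)=\max(A(x)-B(x),0)$. A net is $N=(S,T,F,M_0)$ with $S,T$ disjoint sets of places and transitions, $F:(S\times T)\cup(T\times S)\to\mathbb{N}$ and $M_0:S\to\mathbb{N}$, such that for every $t\in T$ the set $\{s\mid F(s,t)>0\}$ is finite and non-empty and $\{s\mid F(t,s)>0\}$ is finite. For $x\in S\cup T$, ${}^\bullet x(y)=F(y,x)$ and $x^\bullet(y)=F(x,y)$; for a finite multiset $G$ of transitions ${}^\bullet G=\sum_t G(t)\cdot{}^\bullet t$ and $G^\bullet=\sum_t G(t)\cdot t^\bullet$. For markings $M,M':S\to\mathbb{N}$ and a finite non-empty multiset $G$ of transitions, $M\xrightarrow{G}M'$ iff ${}^\bullet G\subseteq M$ and $M'=(M-{}^\bullet G)+G^\bullet$. For a finite word $t_1\cdots t_n$ or infinite word $t_1t_2\cdots$ over $T$, $M\xrightarrow{\sigma}$ means there are markings with $M\xrightarrow{\{t_1\}}M_1\xrightarrow{\{t_2\}}M_2\cdots$. $\mathrm{FS}^\infty(N)$ is the set of (finite or infinite) words $\sigma$ with $M_0\xrightarrow{\sigma}$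 (firing sequences), $\mathrm{FS}(N)$ the finite ones; $\sigma\le\rho$ means $\sigma$ is a prefix of $\rho$. Two firing sequences are adjacent, $\sigma\equiv_0\rho$, iff $\sigma=\sigma_1tu\sigma_2$, $\rho=\sigma_1ut\sigma_2$ and $M_0\xrightarrow{\sigma_1}M\xrightarrow{\{t,u\}}$ for some $M$; $\equiv_0^*$ is its reflexive transitive closure (on firing sequences). For $\sigma,\rho\in\mathrm{FS}^\infty(N)$: $\sigma\sqsubseteq_0^\infty\rho$ iff for every $\sigma''\in\mathrm{FS}(N)$ with $\sigma''\le\sigma$ there are $\sigma',\rho'\in\mathrm{FS}(N)$ with $\sigma''\le\sigma'\equiv_0^*\rho'\le\rho$. A GR-process of $N$ is a pair $P=(\mathcal N,\pi)$ where $\mathcal N=(\mathcal S,\mathcal T,\mathcal F,\mathcal M_0)$ is a net such that every place $s$ has $|{}^\bullet s|\le1$ and $|s^\bullet|\le1$, $\mathcal M_0(s)=1$ if ${}^\bullet s=\emptyset$ and $0$ otherwise; the relation $\mathcal F^+$ (transitive closure of $\{(x,y)\mid\mathcal F(x,y)>0\}$) is irreflexive; and $\{t\in\mathcal T\mid (t,u)\in\mathcal F^+\}$ is finite for every $u\in\mathcal T$; and $\pi:\mathcal S\cup\mathcal T\to S\cup T$ maps places to places and transitions to transitions with $M_0(s)=|\pi^{ -1}(s)\cap\mathcal M_0|$ for all $s\in S$ and, for all $t\in\mathcal T$, $s\in S$: $F(s,\pi(t))=|\pi^{ -1}(s)\cap{}^\bullet t|$ and $F(\pi(t),s)=|\pi^{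 -1}(s)\cap t^\bullet|$. $P$ is finite if $\mathcal T$ is finite. $P'=((\mathcal S',\mathcal T',\mathcal F',\mathcal M_0'),\pi')\le P$ (prefix) iff $\mathcal S'\subseteq\mathcal S$, $\mathcal T'\subseteq\mathcal T$, $\mathcal M_0'=\mathcal M_0$, $\mathcal F'$ is the restriction of $\mathcal F$ to $\mathcal S'\times\mathcal T'\cup\mathcal T'\times\mathcal S'$ and $\pi'$ the restriction of $\pi$. Processes $P,Q$ are isomorphic if there is a bijection $\phi$ between their places and transitions preserving initial marking, flow and with $\pi_P=\pi_Q\circ\phi$. For places $p,q$ of $P$ with $(p,q)\notin\mathcal F^+\cup(\mathcal F^+)^{ -1}$ and $\pi(p)=\pi(q)$, $\mathrm{swap}(P,p,q)$ is $P$ with flow changed to $\mathcal F'(p,y)=\mathcal F(q,y)$, $\mathcal F'(q,y)=\mathcal F(p,y)$ for $y\in\mathcal T$, and $\mathcal F'(x,y)=\mathcal F(x,y)$ otherwise. $P\equiv_1 Q$ iff $\mathrm{swap}(P,p,q)$ is isomorphic to $Q$ for some $p,q$; $\equiv_1^*$ is its reflexive transitive closure. $P\sqsubseteq_1^\infty Q$ iff for every finite GR-process $P''\le P$ there are finite GR-processes $P',Q'$ with $P''\le P'\equiv_1^*Q'\le Q$. A GR-process $P$ with transitions $\mathcal T$ and $\sigma=t_0t_1t_2\cdots\in\mathrm{FS}^\infty(N)$ are compatible iff there is a bijection $\mathrm{pos}:\mathcal T\to I$ (where $I=\{0,\dots,|\sigma|-1\}$ if $\sigma$ is finite and $I=\mathbb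 N$ otherwise) with $\pi(t)=t_{\mathrm{pos}(t)}$ for all $t$ and $(t,t')\in\mathcal F^+\Rightarrow\mathrm{pos}(t)<\mathrm{pos}(t')$. $\mathrm{Lin}(P)$ is the set of firing sequences compatible with $P$. -}

module Defs where

open import Level using (Level; 0ℓ) renaming (suc to lsuc)
open import Data.Nat using (ℕ; zero; suc; _+_; _∸_; _≤_; _<_)
open import Data.Fin as Fin using (Fin)
open import Data.List using (List; []; _∷_; _++_; length; lookup; map)
open import Data.Nat.ListAction using (sum)
open import Data.Empty using (⊥)
open import Data.List.Membership.Propositional using (_∈_)
open import Data.List.Relation.Unary.Unique.Propositional using (Unique)
open import Data.Product using (Σ; ∃; _×_; _,_; proj₁; proj₂)
open import Data.Sum using (_⊎_; inj₁; inj₂)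
open import Data.Unit using (⊤)
open import Relation.Nullary using (¬_)
open import Relation.Binary.PropositionalEquality using (_≡_; _≢_)
open import Relation.Binary.Construct.Closure.Transitive using (TransClosure)
open import Relation.Binary.Construct.Closure.ReflexiveTransitive using (Star)
open import Function.Bundles using (_↔_; _⇔_; Inverse)
open import Function.Definitions using (Injective)

Finite : {A : Set} → (A → Set) → Set
Finite {A} P = Σ (List A) λ l → ∀ x → P x → x ∈ l

MSize : {A : Set} → (A → ℕ) → (A → Set) → ℕ → Set
MSize {A} w P n = Σ (List A) λ l →
  Unique l × (∀ x → (x ∈ l) ⇔ P x) × sum (map w l) ≡ n

AtMostOne : {A : Set} → (A → ℕ) → Set
AtMostOne {A} w = (∀ x → w x ≤ 1) × (∀ x y → 1 ≤ w x → 1 ≤ w y → x ≡ y)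

record Net : Set₁ where
  field
    S T     : Set                -- places and transitions (disjoint as types)
    pre     : S → T → ℕ
    post    : T → S → ℕ
    M0      : S → ℕ
    preFin  : ∀ t → Finite (λ s → 1 ≤ pre s t)
    preNE   : ∀ t → ∃ λ s → 1 ≤ pre s t
    postFin : ∀ t → Finite (λ s → 1 ≤ post t s)

module _ (N : Net) where
  open Net N

  Marking : Set
  Marking = S → ℕ

  Step : Marking → T → Marking → Set
  Step M t M' = (∀ s → pre s t ≤ M s) × (∀ s → M' s ≡ (M s ∸ pre s t) + post t s)

  Enabled2 : Marking → T → T → Set
  Enabled2 M t u = ∀ s → pre s t + pre s u ≤ M s

  data Reach : Marking → List T → Marking → Set where
    done : ∀ {M} → Reach M [] M
    step : ∀ {M M' M'' t σ} → Step M t M' → Reach M' σ M'' → Reach M (t ∷ σ) M''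

  data Word : Set where
    fin : List T → Word
    inf : (ℕ → T) → Word

  FS : List T → Set
  FS σ = ∃ λ M → Reach M0 σ M

  FS∞ : Word → Set
  FS∞ (fin σ) = FS σ
  FS∞ (inf f) = Σ (ℕ → Marking) λ Ms →
    (∀ s → Ms 0 s ≡ M0 s) × (∀ i → Step (Ms i) (f i) (Ms (suc i)))

  _≤fin_ : List T → List T → Set
  σ ≤fin ρ = ∃ λ τ → σ ++ τ ≡ ρ

  _≤w_ : List T → Word → Set
  σ ≤w fin ρ = σ ≤fin ρ
  σ ≤w inf f = ∀ (i : Fin (length σ)) → lookup σ i ≡ f (Fin.toℕ i)

  Adj : List T → List T → Set
  Adj σ ρ = FS σ × FS ρ × Σ (List T) λ σ₁ → Σ T λ t → Σ T λ u → Σ (List T) λ σ₂ →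
    σ ≡ σ₁ ++ (t ∷ u ∷ σ₂) × ρ ≡ σ₁ ++ (u ∷ t ∷ σ₂) ×
    ∃ λ M → Reach M0 σ₁ M × Enabled2 M t u

  _≡₀*_ : List T → List T → Set
  _≡₀*_ = Star Adj

  _⊑₀∞_ : Word → Word → Set
  σ ⊑₀∞ ρ = ∀ σ'' → FS σ'' → σ'' ≤w σ →
    Σ (List T) λ σ' → Σ (List T) λ ρ' →
      FS σ' × FS ρ' × σ'' ≤fin σ' × σ' ≡₀* ρ' × ρ' ≤w ρ

  record ProcData : Set₁ where
    field
      𝒮 𝒯  : Set
      pre𝒩  : 𝒮 → 𝒯 → ℕ
      post𝒩 : 𝒯 → 𝒮 → ℕ
      m0    : 𝒮 → ℕ
      πS    : 𝒮 → S
      πT    : 𝒯 → T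

    Node : Set
    Node = 𝒮 ⊎ 𝒯

    Edge : Node → Node → Set
    Edge (inj₁ s) (inj₂ t) = 1 ≤ pre𝒩 s t
    Edge (inj₂ t) (inj₁ s) = 1 ≤ post𝒩 t s
    Edge (inj₁ _) (inj₁ _) = ⊥
    Edge (inj₂ _) (inj₂ _) = ⊥

    Plus : Node → Node → Set
    Plus = TransClosure Edge

  record IsGR (D : ProcData) : Set where
    open ProcData D
    field
      preFin𝒩  : ∀ t → Finite (λ s → 1 ≤ pre𝒩 s t)
      preNE𝒩   : ∀ t → ∃ λ s → 1 ≤ pre𝒩 s t
      postFin𝒩 : ∀ t → Finite (λ s → 1 ≤ post𝒩 t s)
      inDeg    : ∀ s → AtMostOne (λ t → post𝒩 t s)
      outDeg   : ∀ s → AtMostOne (λ t → pre𝒩 s t)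
      m0-empty    : ∀ s → (∀ t → post𝒩 t s ≡ 0) → m0 s ≡ 1
      m0-nonempty : ∀ s → ¬ (∀ t → post𝒩 t s ≡ 0) → m0 s ≡ 0
      acyclic  : ∀ x → ¬ Plus x x
      finPred  : ∀ u → Finite (λ t → Plus (inj₂ t) (inj₂ u))
      π-M0     : ∀ s → MSize m0 (λ p → πS p ≡ s × 1 ≤ m0 p) (M0 s)
      π-pre    : ∀ t s → MSize (λ p → pre𝒩 p t) (λ p → πS p ≡ s × 1 ≤ pre𝒩 p t) (pre s (πT t))
      π-post   : ∀ t s → MSize (λ p → post𝒩 t p) (λ p → πS p ≡ s × 1 ≤ post𝒩 t p) (post (πT t) s)

  Process : Set₁
  Process = Σ ProcData IsGR

  FiniteP : Process → Set
  FiniteP (D , _) = Finite {ProcData.𝒯 D} (λ _ → ⊤)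

  -- P' ≤ P  (prefix), with 𝒮' ⊆ 𝒮, 𝒯' ⊆ 𝒯 given by inclusion maps
  record _≤P_ (P' P : Process) : Set where
    private
      module D' = ProcData (proj₁ P')
      module D  = ProcData (proj₁ P)
    field
      ιS     : D'.𝒮 → D.𝒮
      ιT     : D'.𝒯 → D.𝒯
      ιS-inj : Injective _≡_ _≡_ ιS
      ιT-inj : Injective _≡_ _≡_ ιT
      m0-eq  : ∀ s → D'.m0 s ≡ D.m0 (ιS s)
      m0-sub : ∀ s → 1 ≤ D.m0 s → ∃ λ s' → ιS s' ≡ s
      pre-eq  : ∀ s t → D'.pre𝒩 s t ≡ D.pre𝒩 (ιS s) (ιT t)
      post-eq : ∀ t s → D'.post𝒩 t s ≡ D.post𝒩 (ιT t) (ιS s)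
      πS-eq  : ∀ s → D'.πS s ≡ D.πS (ιS s)
      πT-eq  : ∀ t → D'.πT t ≡ D.πT (ιT t)

  SwapPre : (D : ProcData) → (p q x : ProcData.𝒮 D) → ProcData.𝒯 D → ℕ → Set
  SwapPre D p q x t n =
    (x ≡ p → n ≡ pre𝒩 q t) × (x ≡ q → n ≡ pre𝒩 p t) × (x ≢ p → x ≢ q → n ≡ pre𝒩 x t)
    where open ProcData D

  -- P ≡₁ Q : swap(P,p,q) is isomorphic to Q for some p, q
  _≡₁_ : Process → Process → Set
  (D , _) ≡₁ (E , _) =
    Σ D.𝒮 λ p → Σ D.𝒮 λ q →
      ¬ D.Plus (inj₁ p) (inj₁ q) × ¬ D.Plus (inj₁ q) (inj₁ p) × D.πS p ≡ D.πS q ×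
      Σ (D.𝒮 ↔ E.𝒮) λ φS → Σ (D.𝒯 ↔ E.𝒯) λ φT →
        (∀ x → E.m0 (Inverse.to φS x) ≡ D.m0 x) ×
        (∀ x t → SwapPre D p q x t (E.pre𝒩 (Inverse.to φS x) (Inverse.to φT t))) ×
        (∀ t x → E.post𝒩 (Inverse.to φT t) (Inverse.to φS x) ≡ D.post𝒩 t x) ×
        (∀ x → E.πS (Inverse.to φS x) ≡ D.πS x) ×
        (∀ t → E.πT (Inverse.to φT t) ≡ D.πT t)
    where
      module D = ProcData D
      module E = ProcData E

  _≡₁*_ : Process → Process → Set₁
  _≡₁*_ = Star _≡₁_

  _⊑₁∞_ : Process → Process → Set₁
  P ⊑₁∞ Q = ∀ (P'' : Process) → FiniteP P'' → P'' ≤P P →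
    Σ Process λ P' → Σ Process λ Q' →
      FiniteP P' × FiniteP Q' × P'' ≤P P' × P' ≡₁* Q' × Q' ≤P Q

  Compatible : Process → Word → Set
  Compatible (D , _) (fin σ) =
    Σ (𝒯 ↔ Fin (length σ)) λ pos →
      (∀ t → πT t ≡ lookup σ (Inverse.to pos t)) ×
      (∀ t t' → Plus (inj₂ t) (inj₂ t') → Inverse.to pos t Fin.< Inverse.to pos t')
    where open ProcData D
  Compatible (D , _) (inf f) =
    Σ (𝒯 ↔ ℕ) λ pos →
      (∀ t → πT t ≡ f (Inverse.to pos t)) ×
      (∀ t t' → Plus (inj₂ t) (inj₂ t') → Inverse.to pos t < Inverse.to pos t')
    where open ProcData D

  Lin : Process → Word → Set
  Lin P σ = FS∞ σ × Compatible P σ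

{-# OPTIONS --safe #-}

-- Along a firing sequence σ the tokens of a place s are created in a fixed order, so up to isomorphism
-- a process with linearisation σ only chooses, for each token of each s, the position in σ of its consumer.
-- Exchanging the consumers of two neighbouring tokens that are out of order is a swap; sorting therefore
-- shows that two processes with the same linearisation are related by ≡₁*. If adjacent t, u of σ are
-- enabled together, u can take tokens older than t, and this process also has the transposed
-- linearisation; hence σ ≡₀* ρ carries processes of σ to processes of ρ by swaps. Conversely, two
-- concurrent places p, q have a linearisation in which their producers come before both of their consumers,
-- and it is shared by P and swap(P,p,q), while all linearisations of one finite process are ≡₀*-related.
-- Both simulations follow by prolonging prefixes along these equivalences.

module Submission where

open import Defs
open import Data.Nat using (ℕ; zero; suc; _+_; _∸_; _≤_; _<_; z≤n; s≤s)
open import Data.Nat.Properties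
open import Data.Nat.ListAction using (sum)
open import Data.Nat.ListAction.Properties using (sum-++)
open import Data.Nat.Tactic.RingSolver using (solve-∀)
open import Data.List using (List; []; _∷_; _++_; length; lookup; map; _ʳ++_; concatMap; replicate; filter; allFin; tabulate)
open import Data.List.Properties using (length-++; map-++; ++-assoc; ++-identityʳ; ∷-injective; map-∘; map-cong; length-map; map-id; map-tabulate; tabulate-lookup; length-replicate; map-replicate)
open import Data.Empty using (⊥-elim)
open import Data.List.Membership.Propositional using (_∈_; _∉_; find; lose)
open import Data.List.Membership.Propositional.Properties
open import Data.List.Relation.Unary.Any as Any using (Any; here; there)
open import Data.List.Relation.Unary.All as All using (All; []; _∷_)
open import Data.List.Relation.Unary.AllPairs using (AllPairs; []; _∷_)
import Data.List.Relation.Unary.AllPairs.Properties as AllPairs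
open import Data.List.Relation.Unary.Unique.Propositional using (Unique)
open import Data.List.Relation.Binary.Subset.Propositional using (_⊆_)
open import Data.Product using (Σ; ∃; ∃₂; _×_; _,_; proj₁; proj₂)
open import Data.Sum using (_⊎_; inj₁; inj₂; [_,_]′)
open import Relation.Nullary using (¬_; Dec; yes; no)
open import Relation.Nullary.Decidable using (¬?; _×-dec_; _⊎-dec_; map′)
open import Relation.Binary.PropositionalEquality using (_≡_; _≢_; _≗_; refl; sym; trans; cong; cong₂; subst; subst₂; module ≡-Reasoning)
open import Relation.Binary.Construct.Closure.ReflexiveTransitive as Star using (Star; ε; _◅_; _◅◅_)
open import Relation.Binary.Construct.Closure.Transitive using ([_]; _∷_)
open import Function.Definitions using (Injective)
open import Function.Bundles using (Equivalence; Inverse; mk↔ₛ′; mk⇔; _⇔_)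
open import Function using (_∘_; id)
import Data.List.Relation.Unary.Any.Properties as Any
import Data.List.Relation.Unary.All.Properties as All
import Data.List.Relation.Unary.Unique.Propositional.Properties as Unique
open import Data.Fin as Fin using (Fin; toℕ; fromℕ<; cast)
open import Data.Fin.Properties as Fin using (toℕ<n; toℕ-fromℕ<; toℕ-injective)
open import Data.Maybe using (Maybe; just; nothing)
open import Data.Maybe.Properties using (just-injective; ≡-dec)
open import Data.Unit using (tt)
import Relation.Binary.Construct.Add.Supremum.NonStrict as Supremum
open import Relation.Unary using (Decidable)

-- Equality of places, transitions and labels is not assumed decidable, and this shapes many steps.
-- Facts usually settled by comparing elements are obtained by counting: enabledness by comparing
-- consumption with production, the completeness of presets in a prefix by the pigeonhole principle.
-- Canonical processes carry their causality in birth and consumption times, which are numbers; the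
-- only labels that must be told apart lie in presets of a finite word. Transitions are compared
-- through their positions in a linearisation.
--
-- `_≡₁_` bundles a swap with an isomorphism, so passing to an isomorphic copy costs the swap of a
-- place with itself, and some place has to exist. A non-empty word provides one.
--
-- Infinite words and processes enter only through finite initial runs. Towards processes, a finite
-- prefix is enclosed in the process of a long enough initial run. Towards words, the transitions of
-- `Q′` may lie scattered in `ρ`; a long enough initial run is rearranged so that their causal past
-- comes first, and the remaining tail is appended on both sides.

module _ {A : Set} where

  ∈-delete : ∀ (as : List A) {bs x y} → y ∈ as ++ x ∷ bs → y ≡ x ⊎ y ∈ as ++ bs
  ∈-delete as m with ∈-++⁻ as m
  ... | inj₁ p = inj₂ (∈-++⁺ˡ p)
  ... | inj₂ (here e) = inj₁ e
  ... | inj₂ (there p) = inj₂ (∈-++⁺ʳ as p)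

  length-insert : ∀ (as : List A) {bs x} → length (as ++ x ∷ bs) ≡ suc (length (as ++ bs))
  length-insert [] = refl
  length-insert (_ ∷ as) = cong suc (length-insert as)

  -- Pigeonhole. Cutting `ys` at the membership proof itself removes one occurrence of `x` without
  -- comparing elements.
  unique-⊆-length : ∀ {xs ys : List A} → Unique xs → xs ⊆ ys → length xs ≤ length ys
  unique-⊆-length [] _ = z≤n
  unique-⊆-length {x ∷ xs} (x∉ ∷ u) sub with ∈-∃++ (sub (here refl))
  ... | as , bs , refl = subst (suc (length xs) ≤_) (sym (length-insert as)) (s≤s (unique-⊆-length u sub′))
    where
    sub′ : xs ⊆ as ++ bs
    sub′ m with ∈-delete as (sub (there m))
    ... | inj₁ refl = ⊥-elim (All.lookup x∉ m refl)
    ... | inj₂ p = p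

  unique-⊆-⊇ : ∀ {xs ys : List A} → Unique xs → xs ⊆ ys → length ys ≤ length xs → ys ⊆ xs
  unique-⊆-⊇ {[]} {[]} _ _ _ m = m
  unique-⊆-⊇ {x ∷ xs} (x∉ ∷ u) sub le m with ∈-∃++ (sub (here refl))
  ... | as , bs , refl with ∈-delete as m
  ... | inj₁ refl = here refl
  ... | inj₂ p = there (unique-⊆-⊇ u sub′ (≤-pred (subst (_≤ suc (length xs)) (length-insert as) le)) p)
    where
    sub′ : xs ⊆ as ++ bs
    sub′ k with ∈-delete as (sub (there k))
    ... | inj₁ refl = ⊥-elim (All.lookup x∉ k refl)
    ... | inj₂ q = q

-- Linearisations of a precedence relation

module Runs {A : Set} (_≺_ : A → A → Set) where

  -- RunFrom d xs: after the elements of d have occurred, those of xs can occur in this order.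
  data RunFrom (d : List A) : List A → Set where
    []   : RunFrom d []
    run∷ : ∀ {x xs} → x ∉ d → (∀ {y} → y ≺ x → y ∈ d) → RunFrom (x ∷ d) xs → RunFrom d (x ∷ xs)

  -- One negated relation suffices: in a run, `y ≺ x` with `y` listed after `x` is impossible. This
  -- is independence of neighbours, as in trace theory.
  data RSwap : List A → List A → Set where
    here  : ∀ {x y xs} → ¬ (x ≺ y) → RSwap (x ∷ y ∷ xs) (y ∷ x ∷ xs)
    there : ∀ {x xs ys} → RSwap xs ys → RSwap (x ∷ xs) (x ∷ ys)

  run-⊆ : ∀ {d e xs} → d ⊆ e → e ⊆ d → RunFrom d xs → RunFrom e xs
  run-⊆ _ _ [] = []
  run-⊆ {d} {e} to from (run∷ {x} n p r) = run∷ (n ∘ from) (to ∘ p) (run-⊆ (ext to) (ext from) r)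
    where
    ext : ∀ {d e} → d ⊆ e → x ∷ d ⊆ x ∷ e
    ext f (here q) = here q
    ext f (there q) = there (f q)

  run-swap : ∀ {d xs ys} → RunFrom d xs → RSwap xs ys → RunFrom d ys
  run-swap {d} (run∷ {x} nx px (run∷ {y} ny py r)) (here x⊀y) =
    run∷ (ny ∘ there) py′ (run∷ nx′ (there ∘ px) (run-⊆ flip flip r))
    where
    py′ : ∀ {z} → z ≺ y → z ∈ d
    py′ z≺y with py z≺y
    ... | here refl = ⊥-elim (x⊀y z≺y)
    ... | there m = m
    nx′ : x ∉ y ∷ d
    nx′ (here refl) = ny (here refl)
    nx′ (there m) = nx m
    flip : ∀ {u v} → u ∷ v ∷ d ⊆ v ∷ u ∷ d
    flip (here e) = there (here e)
    flip (there (here e)) = here e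
    flip (there (there m)) = there (there m)
  run-swap (run∷ n p r) (there s) = run∷ n p (run-swap r s)

  run-star : ∀ {d xs ys} → RunFrom d xs → Star RSwap xs ys → RunFrom d ys
  run-star r ε = r
  run-star r (s ◅ ss) = run-star (run-swap r s) ss

  run-++⁻ˡ : ∀ {d} xs {ys} → RunFrom d (xs ++ ys) → RunFrom d xs
  run-++⁻ˡ [] _ = []
  run-++⁻ˡ (x ∷ xs) (run∷ n p r) = run∷ n p (run-++⁻ˡ xs r)

  run-fresh : ∀ {d xs x} → RunFrom d xs → x ∈ xs → x ∉ d
  run-fresh (run∷ n _ _) (here refl) = n
  run-fresh (run∷ _ _ r) (there m) = run-fresh r m ∘ there

  run-unique : ∀ {d xs} → RunFrom d xs → Unique xs
  run-unique [] = []
  run-unique (run∷ _ _ r) = All.tabulate (λ m → λ { refl → run-fresh r m (here refl) }) ∷ run-unique r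

  swap-∈ : ∀ {xs ys x} → RSwap xs ys → x ∈ xs → x ∈ ys
  swap-∈ (here _) (here e) = there (here e)
  swap-∈ (here _) (there (here e)) = here e
  swap-∈ (here _) (there (there m)) = there (there m)
  swap-∈ (there s) (here e) = here e
  swap-∈ (there s) (there m) = there (swap-∈ s m)

  star-∈ : ∀ {xs ys x} → Star RSwap xs ys → x ∈ xs → x ∈ ys
  star-∈ ε m = m
  star-∈ (s ◅ ss) m = star-∈ ss (swap-∈ s m)

  star-there : ∀ {x xs ys} → Star RSwap xs ys → Star RSwap (x ∷ xs) (x ∷ ys)
  star-there {x} = Star.gmap (x ∷_) there

  -- Elements of `as` are fresh over `d`, whereas every predecessor of `x` is in `d`. So none of
  -- them precedes `x`, and `x` can pass them one at a time.
  bubble : ∀ {d x bs} as → RunFrom d (as ++ x ∷ bs) → (∀ {y} → y ≺ x → y ∈ d) →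
    Star RSwap (as ++ x ∷ bs) (x ∷ as ++ bs)
  bubble [] _ _ = ε
  bubble (a ∷ as) (run∷ n _ r) p =
    star-there (bubble as r (there ∘ p)) ◅◅ here (n ∘ p) ◅ ε

  -- Repeated bubbling. It shows that any two linearisations of the same finite set are connected by
  -- swaps, and that a partial run can always be scheduled first.
  merge : ∀ {d ts us} → RunFrom d ts → RunFrom d us → ts ⊆ us →
    ∃ λ us′ → Star RSwap us (ts ++ us′)
  merge {us = us} [] _ _ = us , ε
  merge {d} {t ∷ ts} (run∷ n p r) r′ sub with ∈-∃++ (sub (here refl))
  ... | as , bs , refl with bubble as r′ p
  ... | β with run-star r′ β
  ... | run∷ _ _ r″ with merge r r″ sub′
    where
    sub′ : ts ⊆ as ++ bs
    sub′ m with ∈-delete as (sub (there m))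
    ... | inj₁ refl = ⊥-elim (run-fresh r m (here refl))
    ... | inj₂ q = q
  ... | us′ , γ = us′ , β ◅◅ star-there γ

  data Below (G : A → Set) : A → Set where
    base : ∀ {x} → G x → Below G x
    pred : ∀ {x y} → x ≺ y → Below G y → Below G x

  private
    delay : ∀ {x bs} as → All (λ a → ¬ (x ≺ a)) as → Star RSwap (x ∷ as ++ bs) (as ++ x ∷ bs)
    delay [] [] = ε
    delay (a ∷ as) (n ∷ ns) = here n ◅ star-there (delay as ns)

  -- Membership in `Below G` is never tested. Scanning from the right, an element joins `as` if it
  -- satisfies `G` or precedes something already in `as`; otherwise it is independent of all of `as`
  -- and can be delayed past it.
  partition : {G : A → Set} → Decidable G → (∀ x y → Dec (x ≺ y)) → ∀ xs →
    ∃₂ λ as bs → Star RSwap xs (as ++ bs) × All (Below G) as × (∀ {x} → x ∈ xs → G x → x ∈ as)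
  partition G? ≺? [] = [] , [] , ε , [] , λ ()
  partition {G} G? ≺? (x ∷ xs) with partition G? ≺? xs
  ... | as , bs , s , below , keeps with G? x | All.all? (λ a → ¬? (≺? x a)) as
  ... | yes g | _ = x ∷ as , bs , star-there s , base g ∷ below ,
    λ { (here refl) _ → here refl ; (there m) h → there (keeps m h) }
  ... | no ¬g | yes none = as , x ∷ bs , (star-there s ◅◅ delay as none) , below ,
    λ { (here refl) h → ⊥-elim (¬g h) ; (there m) h → keeps m h }
  ... | no ¬g | no some = x ∷ as , bs , star-there s , first ∷ below ,
    λ { (here refl) _ → here refl ; (there m) h → there (keeps m h) }
    where
    search : ∀ as → All (Below G) as → ¬ All (λ a → ¬ (x ≺ a)) as → Below G x
    search [] _ k = ⊥-elim (k [])
    search (a ∷ as) (b ∷ bs) k with ≺? x a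
    ... | yes x≺a = pred x≺a b
    ... | no n = search as bs (λ ns → k (n ∷ ns))
    first = search as below some

  -- The reversal reflects that the past of a run grows at its head.
  split-run : ∀ {d} as {bs} → RunFrom d (as ++ bs) → RunFrom (as ʳ++ d) bs
  split-run [] r = r
  split-run (a ∷ as) (run∷ _ _ r) = split-run as r

  join-run : ∀ {d} as {bs} → RunFrom d as → RunFrom (as ʳ++ d) bs → RunFrom d (as ++ bs)
  join-run [] _ r = r
  join-run (a ∷ as) (run∷ n p r) r′ = run∷ n p (join-run as r r′)

module _ {A B : Set} {_≺_ : A → A → Set} {_≺′_ : B → B → Set} where
  open Runs

  -- The hypothesis `back` makes the image closed under predecessors, so that nothing outside it can
  -- block a step.
  run-map : ∀ (f : A → B) {d xs} → Injective _≡_ _≡_ f →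
    (∀ {b u} → u ∈ xs → b ≺′ f u → ∃ λ a → f a ≡ b × a ≺ u) →
    RunFrom _≺_ d xs → RunFrom _≺′_ (map f d) (map f xs)
  run-map f inj back [] = []
  run-map f {d} inj back (run∷ {x} n p r) =
    run∷ n′ p′ (run-map f inj (back ∘ there) r)
    where
    n′ : f x ∉ map f d
    n′ m with ∈-map⁻ f m
    ... | y , m′ , e = n (subst (_∈ d) (sym (inj e)) m′)
    p′ : ∀ {y} → y ≺′ f x → y ∈ map f d
    p′ y≺ with back (here refl) y≺
    ... | a , refl , a≺x = ∈-map⁺ f (p a≺x)

  run-map⁻ : ∀ (f : A → B) {d} xs → Injective _≡_ _≡_ f → (∀ {a u} → a ≺ u → f a ≺′ f u) →
    RunFrom _≺′_ (map f d) (map f xs) → RunFrom _≺_ d xs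
  run-map⁻ f [] inj mono [] = []
  run-map⁻ f {d} (x ∷ xs) inj mono (run∷ n p r) =
    run∷ (n ∘ ∈-map⁺ f) p′ (run-map⁻ f xs inj mono r)
    where
    p′ : ∀ {y} → y ≺ x → y ∈ d
    p′ y≺x with ∈-map⁻ f (p (mono y≺x))
    ... | z , m , e = subst (_∈ d) (sym (inj e)) m

module _ {A : Set} {_≺_ _≺′_ : A → A → Set} where
  open Runs

  -- A precedence that is new in `_≺′_` does no harm when its source already belongs to the past.
  run-change : ∀ {d xs} → RunFrom _≺_ d xs →
    (∀ {t u} → u ∈ xs → t ≺′ u → t ≺ u ⊎ t ∈ d) → RunFrom _≺′_ d xs
  run-change [] _ = []
  run-change (run∷ n p r) h =
    run∷ n (λ y≺ → [ p , id ]′ (h (here refl) y≺))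
      (run-change r λ m y≺ → [ inj₁ , (λ k → inj₂ (there k)) ]′ (h (there m) y≺))

seq : ℕ → ℕ → List ℕ
seq k zero    = []
seq k (suc n) = k ∷ seq (suc k) n

module _ {A : Set} {_≺_ : A → A → Set} (h : A → ℕ) (h-inj : Injective _≡_ _≡_ h)
         (h-mono : ∀ {x y} → x ≺ y → h x < h y) where
  open Runs _≺_

  -- The invariant is that `d` consists exactly of the elements of rank below `k`; predecessors have
  -- smaller rank, hence are there.
  run-seq : ∀ {d} k n xs → map h xs ≡ seq k n →
    (∀ {t} → h t < k → t ∈ d) → (∀ {t} → t ∈ d → h t < k) → RunFrom d xs
  run-seq k zero [] _ _ _ = []
  run-seq {d} k (suc n) (x ∷ xs) e below above =
    run∷ (λ m → <-irrefl hx (above m)) (λ y≺x → below (subst (h _ <_) hx (h-mono y≺x)))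
      (run-seq (suc k) n xs (proj₂ (∷-injective e)) below′ above′)
    where
    hx : h x ≡ k
    hx = proj₁ (∷-injective e)
    below′ : ∀ {t} → h t < suc k → t ∈ x ∷ d
    below′ lt with m≤n⇒m<n∨m≡n (≤-pred lt)
    ... | inj₁ l = there (below l)
    ... | inj₂ q = here (h-inj (trans q (sym hx)))
    above′ : ∀ {t} → t ∈ x ∷ d → h t < suc k
    above′ (here refl) = subst (_< suc k) (sym hx) ≤-refl
    above′ (there m) = m<n⇒m<1+n (above m)

zero⊎pos : ∀ m → m ≡ 0 ⊎ 1 ≤ m
zero⊎pos zero    = inj₁ refl
zero⊎pos (suc m) = inj₂ (s≤s z≤n)

sum-ones : {A : Set} (w : A → ℕ) (l : List A) → (∀ {x} → x ∈ l → w x ≡ 1) → sum (map w l) ≡ length l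
sum-ones w [] _ = refl
sum-ones w (x ∷ l) one = cong₂ _+_ (one (here refl)) (sum-ones w l (one ∘ there))

-- Firing sequences of a process

module Firing (N : Net) where
  open Net N

  consumed produced : S → List T → ℕ
  consumed s σ = sum (map (pre s) σ)
  produced s σ = sum (map (λ t → post t s) σ)

  step-balance : ∀ {M t M'} → Step N M t M' → ∀ s → M' s + pre s t ≡ M s + post t s
  step-balance {M} {t} {M'} (en , eff) s = begin
    M' s + pre s t                        ≡⟨ cong (_+ pre s t) (eff s) ⟩
    M s ∸ pre s t + post t s + pre s t    ≡⟨ shuffle (M s ∸ pre s t) _ _ ⟩
    (M s ∸ pre s t + pre s t) + post t s  ≡⟨ cong (_+ post t s) (m∸n+n≡m (en s)) ⟩
    M s + post t s                        ∎
    where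
    open ≡-Reasoning
    shuffle : ∀ a b c → a + b + c ≡ (a + c) + b
    shuffle = solve-∀

  -- The marking equation, written additively to get rid of truncated subtraction. It determines the
  -- final marking from the initial one and the word.
  reach-balance : ∀ {M σ M'} → Reach N M σ M' → ∀ s → M' s + consumed s σ ≡ M s + produced s σ
  reach-balance done s = refl
  reach-balance {M} {t ∷ σ} {M″} (step {M' = M'} st r) s = +-cancelʳ-≡ (M' s) _ _ (begin
    M″ s + (pre s t + consumed s σ) + M' s        ≡⟨ shuffle (M″ s) _ _ _ ⟩
    (M″ s + consumed s σ) + (M' s + pre s t)      ≡⟨ cong₂ _+_ (reach-balance r s) (step-balance st s) ⟩
    (M' s + produced s σ) + (M s + post t s)      ≡⟨ shuffle′ (M' s) (produced s σ) (M s) _ ⟩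
    M s + (post t s + produced s σ) + M' s        ∎)
    where
    open ≡-Reasoning
    shuffle : ∀ a b c d → a + (b + c) + d ≡ (a + c) + (d + b)
    shuffle = solve-∀
    shuffle′ : ∀ a b c d → (a + b) + (c + d) ≡ c + (d + b) + a
    shuffle′ = solve-∀

  reach-unique : ∀ {M M' K K'} {σ} → M ≗ M' → Reach N M σ K → Reach N M' σ K' → K ≗ K'
  reach-unique {σ = σ} e r r′ s = +-cancelʳ-≡ (consumed s σ) _ _
    (trans (reach-balance r s) (trans (cong (_+ produced s σ) (e s)) (sym (reach-balance r′ s))))

  -- Pointwise equal markings need not be equal as functions, so the run is replayed from `K` and
  -- may end in another function.
  reach-ext : ∀ {M K σ M'} → M ≗ K → Reach N M σ M' → ∃ λ K' → Reach N K σ K'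
  reach-ext {K = K} e done = K , done
  reach-ext {σ = t ∷ σ} e (step {M' = M'} (en , eff) r) =
    _ , step ((λ s → subst (pre s t ≤_) (e s) (en s)) ,
              (λ s → trans (eff s) (cong (λ m → m ∸ pre s t + post t s) (e s)))) r

  reach-++ : ∀ {M σ M' τ M″} → Reach N M σ M' → Reach N M' τ M″ → Reach N M (σ ++ τ) M″
  reach-++ done r = r
  reach-++ (step st r) r′ = step st (reach-++ r r′)

  reach-split : ∀ {M} σ {τ M″} → Reach N M (σ ++ τ) M″ → ∃ λ M' → Reach N M σ M' × Reach N M' τ M″
  reach-split [] r = _ , done , r
  reach-split (t ∷ σ) (step st r) with reach-split σ r
  ... | M' , r₁ , r₂ = M' , step st r₁ , r₂

  fire : ∀ {M t} → (∀ s → pre s t ≤ M s) → Step N M t (λ s → M s ∸ pre s t + post t s)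
  fire en = en , λ _ → refl

  -- Joint enabling lets `u` fire first and leaves enough for `t`. By the marking equation both
  -- orders end in pointwise equal markings, from which `σ₂` is replayed.
  FS-swap : ∀ {σ₁ t u σ₂ M} → FS N (σ₁ ++ t ∷ u ∷ σ₂) → Reach N M0 σ₁ M → Enabled2 N M t u →
    FS N (σ₁ ++ u ∷ t ∷ σ₂)
  FS-swap {σ₁} {t} {u} {σ₂} {M} (_ , r) r₁ en with reach-split σ₁ r
  ... | M₁ , r₁′ , step {M' = A} st₁ (step {M' = B} st₂ r₂) =
    let stu = fire en-u
        stt = fire en-t
        (_ , r₂′) = reach-ext (λ s → +-cancelʳ-≡ (pre s u + pre s t) _ _ (same s stu stt)) r₂
    in _ , reach-++ r₁ (step stu (step stt r₂′))
    where
    M₁≗M : M₁ ≗ M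
    M₁≗M = reach-unique (λ _ → refl) r₁′ r₁
    A′ B′ : S → ℕ
    A′ s = M s ∸ pre s u + post u s
    B′ s = A′ s ∸ pre s t + post t s
    en-u : ∀ s → pre s u ≤ M s
    en-u s = ≤-trans (m≤n+m (pre s u) (pre s t)) (en s)
    en-t : ∀ s → pre s t ≤ A′ s
    en-t s = ≤-trans (subst (_≤ M s ∸ pre s u) (m+n∸n≡m (pre s t) (pre s u)) (∸-monoˡ-≤ (pre s u) (en s)))
                     (m≤m+n _ (post u s))
    open ≡-Reasoning
    shuffle : ∀ a b c → a + (b + c) ≡ (a + b) + c
    shuffle = solve-∀
    shuffle′ : ∀ a b c → a + (b + c) ≡ (a + c) + b
    shuffle′ = solve-∀
    swap-end : ∀ a b c → (a + b) + c ≡ (a + c) + b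
    swap-end = solve-∀
    same : ∀ s → Step N M u A′ → Step N A′ t B′ → B s + (pre s u + pre s t) ≡ B′ s + (pre s u + pre s t)
    same s stu stt = begin
      B s + (pre s u + pre s t)    ≡⟨ shuffle (B s) _ _ ⟩
      B s + pre s u + pre s t      ≡⟨ cong (_+ pre s t) (step-balance st₂ s) ⟩
      A s + post u s + pre s t     ≡⟨ swap-end (A s) _ _ ⟩
      A s + pre s t + post u s     ≡⟨ cong (_+ post u s) (step-balance st₁ s) ⟩
      M₁ s + post t s + post u s   ≡⟨ cong (λ m → m + post t s + post u s) (M₁≗M s) ⟩
      M s + post t s + post u s    ≡⟨ swap-end (M s) _ _ ⟩
      M s + post u s + post t s    ≡⟨ cong (_+ post t s) (step-balance stu s) ⟨
      A′ s + pre s u + post t s    ≡⟨ swap-end (A′ s) _ _ ⟩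
      A′ s + post t s + pre s u    ≡⟨ cong (_+ pre s u) (step-balance stt s) ⟨
      B′ s + pre s t + pre s u     ≡⟨ shuffle′ (B′ s) _ _ ⟨
      B′ s + (pre s u + pre s t)   ∎

  mkAdj : ∀ {σ₁ t u σ₂ M} → FS N (σ₁ ++ t ∷ u ∷ σ₂) → Reach N M0 σ₁ M → Enabled2 N M t u →
    Adj N (σ₁ ++ t ∷ u ∷ σ₂) (σ₁ ++ u ∷ t ∷ σ₂)
  mkAdj {σ₁} {t} {u} {σ₂} fs r en =
    fs , FS-swap fs r en , σ₁ , t , u , σ₂ , refl , refl , _ , r , en

  adj-sym : ∀ {σ ρ} → Adj N σ ρ → Adj N ρ σ
  adj-sym (fs , fs′ , σ₁ , t , u , σ₂ , e , e′ , M , r , en) =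
    fs′ , fs , σ₁ , u , t , σ₂ , e′ , e , M , r , λ s → subst (_≤ M s) (+-comm (pre s t) (pre s u)) (en s)

  adj-suffix : ∀ {σ ρ} τ → FS N (σ ++ τ) → Adj N σ ρ → Adj N (σ ++ τ) (ρ ++ τ)
  adj-suffix τ fs (_ , _ , σ₁ , t , u , σ₂ , refl , refl , M , r , en) =
    subst₂ (Adj N) (sym (++-assoc σ₁ _ τ)) (sym (++-assoc σ₁ _ τ))
      (mkAdj (subst (FS N) (++-assoc σ₁ _ τ) fs) r en)

  star-suffix : ∀ {σ ρ} τ → FS N (σ ++ τ) → _≡₀*_ N σ ρ → _≡₀*_ N (σ ++ τ) (ρ ++ τ)
  star-suffix τ fs ε = ε
  star-suffix τ fs (a ◅ as) = let a′ = adj-suffix τ fs a in a′ ◅ star-suffix τ (proj₁ (proj₂ a′)) as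

  star-FS : ∀ {σ ρ} → FS N σ → _≡₀*_ N σ ρ → FS N ρ
  star-FS fs ε = fs
  star-FS fs ((_ , fs′ , _) ◅ as) = star-FS fs′ as

  -- Causality, configurations and runs of a process

  module Occurrences (P : Process N) where
    private D = proj₁ P
    open ProcData D
    open IsGR (proj₂ P)

    Precedes : 𝒯 → 𝒯 → Set
    Precedes t u = ∃ λ s → 1 ≤ post𝒩 t s × 1 ≤ pre𝒩 s u

    precedes⇒plus : ∀ {t u} → Precedes t u → Plus (inj₂ t) (inj₂ u)
    precedes⇒plus (s , a , b) = _∷_ {y = inj₁ s} a [ b ]

    -- Any connecting place is an output of `t`, and these are finitely many.
    precedes? : ∀ t u → Dec (Precedes t u)
    precedes? t u with Any.any? (λ s → (1 ≤? post𝒩 t s) ×-dec (1 ≤? pre𝒩 s u)) (proj₁ (postFin𝒩 t))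
    ... | yes a = let (s , _ , p) = find a in yes (s , p)
    ... | no n = no λ { (s , a , b) → n (lose (proj₂ (postFin𝒩 t) s a) (a , b)) }

    open Runs Precedes public

    initial : S → List 𝒮
    initial s = proj₁ (π-M0 s)
    inputs outputs : S → 𝒯 → List 𝒮
    inputs s t = proj₁ (π-pre t s)
    outputs s t = proj₁ (π-post t s)

    ∈-initial⁻ : ∀ {s p} → p ∈ initial s → πS p ≡ s × 1 ≤ m0 p
    ∈-initial⁻ = Equivalence.to (proj₁ (proj₂ (proj₂ (π-M0 _))) _)
    ∈-initial⁺ : ∀ {s p} → πS p ≡ s → 1 ≤ m0 p → p ∈ initial s
    ∈-initial⁺ a b = Equivalence.from (proj₁ (proj₂ (proj₂ (π-M0 _))) _) (a , b)
    ∈-inputs⁻ : ∀ {s t p} → p ∈ inputs s t → πS p ≡ s × 1 ≤ pre𝒩 p t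
    ∈-inputs⁻ = Equivalence.to (proj₁ (proj₂ (proj₂ (π-pre _ _))) _)
    ∈-inputs⁺ : ∀ {s t p} → πS p ≡ s → 1 ≤ pre𝒩 p t → p ∈ inputs s t
    ∈-inputs⁺ a b = Equivalence.from (proj₁ (proj₂ (proj₂ (π-pre _ _))) _) (a , b)
    ∈-outputs⁻ : ∀ {s t p} → p ∈ outputs s t → πS p ≡ s × 1 ≤ post𝒩 t p
    ∈-outputs⁻ = Equivalence.to (proj₁ (proj₂ (proj₂ (π-post _ _))) _)
    ∈-outputs⁺ : ∀ {s t p} → πS p ≡ s → 1 ≤ post𝒩 t p → p ∈ outputs s t
    ∈-outputs⁺ a b = Equivalence.from (proj₁ (proj₂ (proj₂ (π-post _ _))) _) (a , b)

    produced⇒m0≡0 : ∀ {p t} → 1 ≤ post𝒩 t p → m0 p ≡ 0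
    produced⇒m0≡0 {p} {t} a = m0-nonempty p λ all0 → <-irrefl (sym (all0 t)) a

    m0≤1 : ∀ p → m0 p ≤ 1
    m0≤1 p with zero⊎pos (m0 p)
    ... | inj₁ e = subst (_≤ 1) (sym e) z≤n
    ... | inj₂ pos = ≤-reflexive (m0-empty p λ t → [ id , (λ a → ⊥-elim (<-irrefl (sym (produced⇒m0≡0 a)) pos)) ]′ (zero⊎pos (post𝒩 t p)))

    length-initial : ∀ s → length (initial s) ≡ M0 s
    length-initial s = trans (sym (sum-ones m0 (initial s) λ m → ≤-antisym (m0≤1 _) (proj₂ (∈-initial⁻ m))))
                             (proj₂ (proj₂ (proj₂ (π-M0 s))))

    length-inputs : ∀ s t → length (inputs s t) ≡ pre s (πT t)
    length-inputs s t = trans (sym (sum-ones (λ p → pre𝒩 p t) (inputs s t) λ m → ≤-antisym (proj₁ (outDeg _) t) (proj₂ (∈-inputs⁻ m))))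
                              (proj₂ (proj₂ (proj₂ (π-pre t s))))

    length-outputs : ∀ s t → length (outputs s t) ≡ post (πT t) s
    length-outputs s t = trans (sym (sum-ones (post𝒩 t) (outputs s t) λ m → ≤-antisym (proj₁ (inDeg _) t) (proj₂ (∈-outputs⁻ m))))
                               (proj₂ (proj₂ (proj₂ (π-post t s))))

    -- The axioms on `m0` yield a producer only in negated form. A finite list containing every
    -- possible producer turns this into a search.
    origin : ∀ {p} d → (∀ {t} → 1 ≤ post𝒩 t p → t ∈ d) → 1 ≤ m0 p ⊎ ∃ λ t → t ∈ d × 1 ≤ post𝒩 t p
    origin {p} d inside with Any.any? (λ t → 1 ≤? post𝒩 t p) d
    ... | yes a = inj₂ (find a)
    ... | no n = inj₁ (≤-reflexive (sym (m0-empty p λ t →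
      [ id , (λ a → ⊥-elim (n (lose (inside a) a))) ]′ (zero⊎pos (post𝒩 t p)))))

    private
      allInputs : S → List 𝒯 → List 𝒮
      allInputs s = concatMap (inputs s)
      available : S → List 𝒯 → List 𝒮
      available s d = initial s ++ concatMap (outputs s) d

      length-concatMap : {A B : Set} (f : A → List B) (w : A → ℕ) → (∀ x → length (f x) ≡ w x) →
        ∀ l → length (concatMap f l) ≡ sum (map w l)
      length-concatMap f w e [] = refl
      length-concatMap f w e (x ∷ l) = trans (length-++ (f x)) (cong₂ _+_ (e x) (length-concatMap f w e l))

      ∈-allInputs⁻ : ∀ {s p} e → p ∈ allInputs s e → ∃ λ t → t ∈ e × p ∈ inputs s t
      ∈-allInputs⁻ e m = find (∈-concatMap⁻ (inputs _) {xs = e} m)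

      unique-allInputs : ∀ s {e} → Unique e → Unique (allInputs s e)
      unique-allInputs s [] = []
      unique-allInputs s {t ∷ e} (t∉ ∷ u) = Unique.++⁺ (proj₁ (proj₂ (π-pre t s))) (unique-allInputs s u) disjoint
        where
        disjoint : ∀ {p} → ¬ (p ∈ inputs s t × p ∈ allInputs s e)
        disjoint (m , m′) with ∈-allInputs⁻ e m′
        ... | t′ , k , m″ = All.lookup t∉ k (proj₂ (outDeg _) t t′ (proj₂ (∈-inputs⁻ m)) (proj₂ (∈-inputs⁻ m″)))

    word : List 𝒯 → List T
    word = map πT

    -- The input places of e are distinct, and each is initial or an output of d.
    inputs-available : ∀ {d e} → Unique e → (∀ {t u} → u ∈ e → Precedes t u → t ∈ d) →
      ∀ s → consumed s (word e) ≤ M0 s + produced s (word d)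
    inputs-available {d} {e} uniq closed s = begin
      consumed s (word e)                            ≡⟨ cong sum (sym (map-∘ e)) ⟩
      sum (map (pre s ∘ πT) e)                       ≡⟨ length-concatMap (inputs s) (pre s ∘ πT) (length-inputs s) e ⟨
      length (allInputs s e)                         ≤⟨ unique-⊆-length (unique-allInputs s uniq) incl ⟩
      length (available s d)                         ≡⟨ length-++ (initial s) ⟩
      length (initial s) + length (concatMap (outputs s) d)
        ≡⟨ cong₂ _+_ (length-initial s) (length-concatMap (outputs s) (λ t → post (πT t) s) (length-outputs s) d) ⟩
      M0 s + sum (map (λ t → post (πT t) s) d)       ≡⟨ cong (λ l → M0 s + sum l) (map-∘ d) ⟩
      M0 s + produced s (word d)                     ∎
      where
      open ≤-Reasoning
      incl : allInputs s e ⊆ available s d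
      incl m with ∈-allInputs⁻ e m
      ... | u , u∈e , m′ with ∈-inputs⁻ m′
      ... | refl , a with origin d (λ b → closed u∈e (_ , b , a))
      ... | inj₁ i = ∈-++⁺ˡ (∈-initial⁺ refl i)
      ... | inj₂ (t , t∈d , b) = ∈-++⁺ʳ (initial s) (∈-concatMap⁺ (outputs s) (lose t∈d (∈-outputs⁺ refl b)))

    -- A finite configuration of the occurrence net.
    Closed : List 𝒯 → Set
    Closed d = Unique d × (∀ {t u} → u ∈ d → Precedes t u → t ∈ d)

    closed-∷ : ∀ {d t} → Closed d → t ∉ d → (∀ {u} → Precedes u t → u ∈ d) → Closed (t ∷ d)
    closed-∷ (uniq , cl) n p =
      (All.tabulate (λ m → λ { refl → n m }) ∷ uniq) ,
      λ { (here refl) q → there (p q) ; (there m) q → there (cl m q) }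

    -- The marking equation in place of reachability: it ignores the order of `d`, which lists the
    -- latest transition first.
    Reached : List 𝒯 → (S → ℕ) → Set
    Reached d M = ∀ s → M s + consumed s (word d) ≡ M0 s + produced s (word d)

    -- `inputs-available` for `e ++ d` bounds what both consume together; cancelling the share of
    -- `d` leaves enough for all of `e` at once. One transition in `e` gives firing, two give the
    -- joint enabling demanded by `Adj`.
    run-enabled : ∀ {d e M} → Closed d → Reached d M → Unique (e ++ d) →
      (∀ {t u} → u ∈ e → Precedes t u → t ∈ d) → ∀ s → consumed s (word e) ≤ M s
    run-enabled {d} {e} {M} (_ , cl) bal uniq p s = +-cancelʳ-≤ (consumed s (word d)) _ _ (begin
      consumed s (word e) + consumed s (word d)  ≡⟨ sum-++ (map (pre s) (word e)) _ ⟨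
      sum (map (pre s) (word e) ++ map (pre s) (word d)) ≡⟨ cong sum (map-++ (pre s) (word e) (word d)) ⟨
      consumed s (word e ++ word d)              ≡⟨ cong (consumed s) (map-++ πT e d) ⟨
      consumed s (word (e ++ d))                 ≤⟨ inputs-available uniq (λ m → [ p , cl ]′ (∈-++⁻ e m)) s ⟩
      M0 s + produced s (word d)                 ≡⟨ bal s ⟨
      M s + consumed s (word d)                  ∎)
      where open ≤-Reasoning

    reached-step : ∀ d {t M M'} → Reached d M → Step N M (πT t) M' → Reached (t ∷ d) M'
    reached-step d {t} {M} {M'} bal st s = begin
      M' s + (pre s (πT t) + consumed s (word d))   ≡⟨ +-assoc (M' s) _ _ ⟨
      M' s + pre s (πT t) + consumed s (word d)     ≡⟨ cong (_+ consumed s (word d)) (step-balance st s) ⟩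
      M s + post (πT t) s + consumed s (word d)     ≡⟨ shuffle (M s) _ _ ⟩
      M s + consumed s (word d) + post (πT t) s     ≡⟨ cong (_+ post (πT t) s) (bal s) ⟩
      M0 s + produced s (word d) + post (πT t) s    ≡⟨ shuffle′ (M0 s) _ _ ⟩
      M0 s + (post (πT t) s + produced s (word d))  ∎
      where
      open ≡-Reasoning
      shuffle : ∀ a b c → a + b + c ≡ a + c + b
      shuffle = solve-∀
      shuffle′ : ∀ a b c → a + b + c ≡ a + (c + b)
      shuffle′ = solve-∀

    run-fires : ∀ {d xs M} → Closed d → Reached d M → RunFrom d xs → ∃ λ M' → Reach N M (word xs) M'
    run-fires cl bal [] = _ , done
    run-fires {d} {x ∷ _} {M} cl bal (run∷ n p r) =
      let st = fire en
          (_ , r′) = run-fires (closed-∷ cl n p) (reached-step d {x} bal st) r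
      in _ , step st r′
      where
      en : ∀ s → pre s (πT x) ≤ M s
      en s = subst (_≤ M s) (+-identityʳ _)
        (run-enabled {e = x ∷ []} cl bal (proj₁ (closed-∷ cl n p)) (λ { (here refl) → p }) s)

    run-FS : ∀ {xs} → RunFrom [] xs → FS N (word xs)
    run-FS = run-fires ([] , λ ()) (λ s → refl)

    private
      swap-adj-from : ∀ {d xs ys M σ} → Closed d → Reached d M → Reach N M0 σ M →
        RunFrom d xs → RSwap xs ys → Adj N (σ ++ word xs) (σ ++ word ys)
      swap-adj-from {d} {x ∷ y ∷ xs} {M = M} {σ} cl bal rσ r@(run∷ nx px (run∷ ny py _)) (here x⊀y) =
        mkAdj (_ , reach-++ rσ (proj₂ (run-fires cl bal r))) rσ en
        where
        py′ : ∀ {z} → Precedes z y → z ∈ d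
        py′ z≺y with py z≺y
        ... | here refl = ⊥-elim (x⊀y z≺y)
        ... | there m = m
        en : Enabled2 N M (πT x) (πT y)
        en s = subst (_≤ M s) (trans (sym (+-assoc (pre s (πT y)) _ 0)) (trans (+-identityʳ _) (+-comm (pre s (πT y)) _)))
          (run-enabled {e = y ∷ x ∷ []} cl bal (proj₁ (closed-∷ (closed-∷ cl nx px) ny py))
            (λ { (here refl) → py′ ; (there (here refl)) → px }) s)
      swap-adj-from {d} {x ∷ xs} {x ∷ ys} {M} {σ} cl bal rσ r@(run∷ n p r′) (there sw) with run-fires cl bal r
      ... | _ , step st _ = subst₂ (Adj N) (++-assoc σ _ _) (++-assoc σ _ _)
        (swap-adj-from (closed-∷ cl n p) (reached-step d {x} bal st) (reach-++ rσ (step st done)) r′ sw)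

    star-adj : ∀ {xs ys} → RunFrom [] xs → Star RSwap xs ys → _≡₀*_ N (word xs) (word ys)
    star-adj r ε = ε
    star-adj r (s ◅ ss) =
      swap-adj-from {σ = []} ([] , λ ()) (λ _ → refl) done r s ◅ star-adj (run-swap r s) ss

-- Prefixes and swaps of processes

module Prefixes (N : Net) where
  open Net N
  open Firing N

  ≤P-trans : ∀ {P Q R} → _≤P_ N P Q → _≤P_ N Q R → _≤P_ N P R
  ≤P-trans {R = R} f g = record
    { ιS = G.ιS ∘ F.ιS ; ιT = G.ιT ∘ F.ιT
    ; ιS-inj = F.ιS-inj ∘ G.ιS-inj ; ιT-inj = F.ιT-inj ∘ G.ιT-inj
    ; m0-eq = λ s → trans (F.m0-eq s) (G.m0-eq _)
    ; m0-sub = λ s a → let (s₁ , e₁) = G.m0-sub s a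
                           (s₂ , e₂) = F.m0-sub s₁ (subst (1 ≤_) (sym (trans (G.m0-eq s₁) (cong (ProcData.m0 (proj₁ R)) e₁))) a)
                       in s₂ , trans (cong G.ιS e₂) e₁
    ; pre-eq = λ s t → trans (F.pre-eq s t) (G.pre-eq _ _)
    ; post-eq = λ t s → trans (F.post-eq t s) (G.post-eq _ _)
    ; πS-eq = λ s → trans (F.πS-eq s) (G.πS-eq _)
    ; πT-eq = λ t → trans (F.πT-eq t) (G.πT-eq _)
    }
    where
    module F = _≤P_ f
    module G = _≤P_ g

  ≤P-factor : ∀ {P R Q} (f : _≤P_ N P Q) (g : _≤P_ N R Q) →
    (∀ s → ∃ λ s′ → _≤P_.ιS g s′ ≡ _≤P_.ιS f s) → (∀ t → ∃ λ t′ → _≤P_.ιT g t′ ≡ _≤P_.ιT f t) → _≤P_ N P R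
  ≤P-factor {P} {R} {Q} f g hS hT = record
    { ιS = proj₁ ∘ hS ; ιT = proj₁ ∘ hT
    ; ιS-inj = λ {x} {y} e → F.ιS-inj (trans (sym (proj₂ (hS x))) (trans (cong G.ιS e) (proj₂ (hS y))))
    ; ιT-inj = λ {x} {y} e → F.ιT-inj (trans (sym (proj₂ (hT x))) (trans (cong G.ιT e) (proj₂ (hT y))))
    ; m0-eq = λ s → trans (F.m0-eq s) (trans (cong D.m0 (sym (proj₂ (hS s)))) (sym (G.m0-eq _)))
    ; m0-sub = λ s a → let (s₁ , e₁) = F.m0-sub (G.ιS s) (subst (1 ≤_) (G.m0-eq s) a)
                       in s₁ , G.ιS-inj (trans (proj₂ (hS s₁)) e₁)
    ; pre-eq = λ s t → trans (F.pre-eq s t) (trans (cong₂ D.pre𝒩 (sym (proj₂ (hS s))) (sym (proj₂ (hT t)))) (sym (G.pre-eq _ _)))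
    ; post-eq = λ t s → trans (F.post-eq t s) (trans (cong₂ D.post𝒩 (sym (proj₂ (hT t))) (sym (proj₂ (hS s)))) (sym (G.post-eq _ _)))
    ; πS-eq = λ s → trans (F.πS-eq s) (trans (cong D.πS (sym (proj₂ (hS s)))) (sym (G.πS-eq _)))
    ; πT-eq = λ t → trans (F.πT-eq t) (trans (cong D.πT (sym (proj₂ (hT t)))) (sym (G.πT-eq _)))
    }
    where
    module F = _≤P_ f
    module G = _≤P_ g
    module D = ProcData (proj₁ Q)

  -- Swapping `p` with itself changes nothing, so a single step expresses the isomorphism. The
  -- argument `p` supplies the place for this trivial swap, and acyclicity its side conditions.
  ≤P-surj⇒≡₁ : ∀ {P Q} (f : _≤P_ N P Q) → (∀ s → ∃ λ s′ → _≤P_.ιS f s′ ≡ s) →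
    (∀ t → ∃ λ t′ → _≤P_.ιT f t′ ≡ t) → ProcData.𝒮 (proj₁ Q) → _≡₁_ N Q P
  ≤P-surj⇒≡₁ {P} {Q} f hS hT p =
    p , p , IsGR.acyclic (proj₂ Q) _ , IsGR.acyclic (proj₂ Q) _ , refl ,
    mk↔ₛ′ (proj₁ ∘ hS) F.ιS (λ x → F.ιS-inj (proj₂ (hS (F.ιS x)))) (proj₂ ∘ hS) ,
    mk↔ₛ′ (proj₁ ∘ hT) F.ιT (λ x → F.ιT-inj (proj₂ (hT (F.ιT x)))) (proj₂ ∘ hT) ,
    (λ x → trans (F.m0-eq _) (cong D.m0 (proj₂ (hS x)))) ,
    (λ x t → let e = trans (F.pre-eq _ _) (cong₂ D.pre𝒩 (proj₂ (hS x)) (proj₂ (hT t)))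
             in (λ { refl → e }) , (λ { refl → e }) , λ _ _ → e) ,
    (λ t x → trans (F.post-eq _ _) (cong₂ D.post𝒩 (proj₂ (hT t)) (proj₂ (hS x)))) ,
    (λ x → trans (F.πS-eq _) (cong D.πS (proj₂ (hS x)))) ,
    (λ t → trans (F.πT-eq _) (cong D.πT (proj₂ (hT t))))
    where
    module F = _≤P_ f
    module D = ProcData (proj₁ Q)

  module _ {P Q : Process N} (f : _≤P_ N P Q) (finite : FiniteP N P) where
    private
      module F = _≤P_ f
      module P = ProcData (proj₁ P)
      module Q = ProcData (proj₁ Q)
      module OP = Occurrences P
      module OQ = Occurrences Q

    prefix-input : ∀ {s u} → 1 ≤ Q.pre𝒩 s (F.ιT u) → ∃ λ s′ → F.ιS s′ ≡ s
    prefix-input {s} {u} a with ∈-map⁻ F.ιS (unique-⊆-⊇ uniq incl (≤-reflexive len) (OQ.∈-inputs⁺ {t = F.ιT u} refl a))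
      where
      σ = Q.πS s
      uniq : Unique (map F.ιS (OP.inputs σ u))
      uniq = Unique.map⁺ F.ιS-inj (proj₁ (proj₂ (IsGR.π-pre (proj₂ P) u σ)))
      incl : map F.ιS (OP.inputs σ u) ⊆ OQ.inputs σ (F.ιT u)
      incl m with ∈-map⁻ F.ιS m
      ... | s′ , m′ , refl with OP.∈-inputs⁻ m′
      ... | e , b = OQ.∈-inputs⁺ (trans (sym (F.πS-eq s′)) e) (subst (1 ≤_) (F.pre-eq s′ u) b)
      len : length (OQ.inputs σ (F.ιT u)) ≡ length (map F.ιS (OP.inputs σ u))
      len = begin
        length (OQ.inputs σ (F.ιT u))           ≡⟨ OQ.length-inputs σ (F.ιT u) ⟩
        pre σ (Q.πT (F.ιT u))                   ≡⟨ cong (pre σ) (F.πT-eq u) ⟨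
        pre σ (P.πT u)                          ≡⟨ OP.length-inputs σ u ⟨
        length (OP.inputs σ u)                  ≡⟨ length-map F.ιS (OP.inputs σ u) ⟨
        length (map F.ιS (OP.inputs σ u))       ∎
        where open ≡-Reasoning
    ... | s′ , _ , e = s′ , sym e

    place-origin : ∀ s → 1 ≤ P.m0 s ⊎ ∃ λ t → 1 ≤ P.post𝒩 t s
    place-origin s with OP.origin {s} (proj₁ finite) (λ _ → proj₂ finite _ _)
    ... | inj₁ i = inj₁ i
    ... | inj₂ (t , _ , a) = inj₂ (t , a)

    -- The connecting place lies in `P`. It cannot be initial there, since initial markings agree;
    -- so it has a producer in `P`, and `t` must be its image because a place has at most one
    -- producer.
    prefix-closed : ∀ {t u} → OQ.Precedes t (F.ιT u) → ∃ λ t′ → F.ιT t′ ≡ t × OP.Precedes t′ u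
    prefix-closed {t} {u} (s , a , b) with prefix-input b
    ... | s′ , refl with place-origin s′
    ... | inj₁ i = ⊥-elim (<-irrefl (sym (trans (F.m0-eq s′) (OQ.produced⇒m0≡0 a))) i)
    ... | inj₂ (t′ , c) = t′ ,
      proj₂ (IsGR.inDeg (proj₂ Q) (F.ιS s′)) _ _ (subst (1 ≤_) (F.post-eq t′ s′) c) a ,
      s′ , c , subst (1 ≤_) (sym (F.pre-eq s′ u)) b

    prefix-run : ∀ {xs} → OP.RunFrom [] xs → OQ.RunFrom [] (map F.ιT xs)
    prefix-run = run-map F.ιT F.ιT-inj (λ _ → prefix-closed)

    prefix-run⁻ : ∀ xs → OQ.RunFrom [] (map F.ιT xs) → OP.RunFrom [] xs
    prefix-run⁻ xs = run-map⁻ F.ιT xs F.ιT-inj λ { (s , a , b) →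
      F.ιS s , subst (1 ≤_) (F.post-eq _ s) a , subst (1 ≤_) (F.pre-eq s _) b }

    prefix-word : ∀ xs → OQ.word (map F.ιT xs) ≡ OP.word xs
    prefix-word xs = trans (sym (map-∘ xs)) (map-cong (λ t → sym (F.πT-eq t)) xs)

  CompleteRun : (P : Process N) → List (ProcData.𝒯 (proj₁ P)) → Set
  CompleteRun P xs = Occurrences.RunFrom P [] xs × (∀ t → t ∈ xs)

  -- A run of Q in which the producers of p and q and their causes come first is also a run of P.
  swap-run : ∀ {P Q vs} → _≡₁_ N P Q → CompleteRun Q vs →
    ∃ λ ws → CompleteRun P ws × _≡₀*_ N (Occurrences.word P ws) (Occurrences.word Q vs)
  swap-run {P} {Q} {vs} (p , q , ¬pq , ¬qp , _ , φS , φT , _ , preE , postE , _ , πTE) (run , complete) =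
    map g (as ++ bs) ,
    (run-map g g-inj
      (λ {b} {u} _ b≺ → f b , IT.strictlyInverseʳ b , subst (λ z → OP.Precedes z (g u)) (sym (IT.strictlyInverseʳ b)) b≺)
      runD ,
     λ t → subst (_∈ map g (as ++ bs)) (IT.strictlyInverseʳ t) (∈-map⁺ g (OQ.star-∈ star (complete (f t))))) ,
    subst (λ w → _≡₀*_ N w (OQ.word vs)) (sym words) (Star.reverse adj-sym (OQ.star-adj run star))
    where
    module D = ProcData (proj₁ P)
    module E = ProcData (proj₁ Q)
    module OP = Occurrences P
    module OQ = Occurrences Q
    module IS = Inverse φS
    module IT = Inverse φT
    f = IT.to
    g = IT.from
    g-inj : ∀ {x y} → g x ≡ g y → x ≡ y
    g-inj {x} {y} e = trans (sym (IT.strictlyInverseˡ x)) (trans (cong f e) (IT.strictlyInverseˡ y))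

    postQ : ∀ x s → E.post𝒩 x (IS.to s) ≡ D.post𝒩 (g x) s
    postQ x s = trans (cong (λ z → E.post𝒩 z (IS.to s)) (sym (IT.strictlyInverseˡ x))) (postE (g x) s)
    preQ : ∀ s x → SwapPre N (proj₁ P) p q s (g x) (E.pre𝒩 (IS.to s) x)
    preQ s x = subst (λ z → SwapPre N (proj₁ P) p q s (g x) (E.pre𝒩 (IS.to s) z)) (IT.strictlyInverseˡ x) (preE s (g x))

    Producer : E.𝒯 → Set
    Producer x = 1 ≤ D.post𝒩 (g x) p ⊎ 1 ≤ D.post𝒩 (g x) q
    producer? : ∀ x → Dec (Producer x)
    producer? x = (1 ≤? _) ⊎-dec (1 ≤? _)

    Reaches : E.𝒯 → Set
    Reaches x = D.Plus (inj₂ (g x)) (inj₁ p) ⊎ D.Plus (inj₂ (g x)) (inj₁ q)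

    consumes-p : ∀ {x} → 1 ≤ D.pre𝒩 p (g x) → ¬ Reaches x
    consumes-p a (inj₁ r) = IsGR.acyclic (proj₂ P) (inj₁ p) (_∷_ {y = inj₂ _} a r)
    consumes-p a (inj₂ r) = ¬pq (_∷_ {y = inj₂ _} a r)
    consumes-q : ∀ {x} → 1 ≤ D.pre𝒩 q (g x) → ¬ Reaches x
    consumes-q a (inj₁ r) = ¬qp (_∷_ {y = inj₂ _} a r)
    consumes-q a (inj₂ r) = IsGR.acyclic (proj₂ P) (inj₁ q) (_∷_ {y = inj₂ _} a r)

    -- Double negation, because equality of places need not be decidable.
    reaches : ∀ {x} → OQ.Below Producer x → ¬ ¬ Reaches x
    reaches (Runs.base (inj₁ a)) k = k (inj₁ [ a ])
    reaches (Runs.base (inj₂ a)) k = k (inj₂ [ a ])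
    reaches {x} (Runs.pred {y = y} (z , a , b) bel) k = reaches bel λ r →
      -- The connecting place is neither `p` nor `q`: after the swap, a consumer of one of them
      -- consumes the other in `P`, and such a transition cannot lie before `p` or `q`. So the edge
      -- is unaffected by the swap.
      k (extend (subst (1 ≤_) (proj₂ (proj₂ swp)
           (λ e → consumes-q (subst (1 ≤_) (proj₁ swp e) b′) r)
           (λ e → consumes-p (subst (1 ≤_) (proj₁ (proj₂ swp) e) b′) r)) b′) r)
      where
      s = IS.from z
      a′ : 1 ≤ D.post𝒩 (g x) s
      a′ = subst (1 ≤_) (trans (cong (E.post𝒩 x) (sym (IS.strictlyInverseˡ z))) (postQ x s)) a
      b′ : 1 ≤ E.pre𝒩 (IS.to s) y
      b′ = subst (λ z → 1 ≤ E.pre𝒩 z y) (sym (IS.strictlyInverseˡ z)) b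
      swp = preQ s y
      extend : 1 ≤ D.pre𝒩 s (g y) → Reaches y → Reaches x
      extend c (inj₁ r) = inj₁ (_∷_ {y = inj₁ s} a′ (_∷_ {y = inj₂ (g y)} c r))
      extend c (inj₂ r) = inj₂ (_∷_ {y = inj₁ s} a′ (_∷_ {y = inj₂ (g y)} c r))

    parts = OQ.partition producer? OQ.precedes? vs
    as = proj₁ parts
    bs = proj₁ (proj₂ parts)
    star = proj₁ (proj₂ (proj₂ parts))
    below = proj₁ (proj₂ (proj₂ (proj₂ parts)))
    keeps = proj₂ (proj₂ (proj₂ (proj₂ parts)))

    _≺′_ : E.𝒯 → E.𝒯 → Set
    t ≺′ u = OP.Precedes (g t) (g u)

    unswapped : ∀ {t u s} → 1 ≤ D.post𝒩 (g t) s → 1 ≤ D.pre𝒩 s (g u) → s ≢ p → s ≢ q → OQ.Precedes t u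
    unswapped {t} {u} {s} a b np nq = IS.to s , subst (1 ≤_) (sym (postQ t s)) a ,
      subst (1 ≤_) (sym (proj₂ (proj₂ (preQ s u)) np nq)) b

    -- Transitions of `as` lie causally before `p` or `q`, so they consume neither, and all their
    -- input edges are the same in both processes.
    as-order : ∀ {t u} → u ∈ as → t ≺′ u → OQ.Precedes t u ⊎ t ∈ []
    as-order {t} {u} m (s , a , b) = inj₁ (unswapped a b
      (λ { refl → reaches (All.lookup below m) (consumes-p b) })
      (λ { refl → reaches (All.lookup below m) (consumes-q b) }))

    -- An edge altered by the swap starts at a producer of `p` or `q`. All of these are already in
    -- `as`, so the order they impose holds anyway.
    bs-order : ∀ {t u} → u ∈ bs → t ≺′ u → OQ.Precedes t u ⊎ t ∈ as ʳ++ []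
    bs-order {t} {u} m (s , a , b) with producer? t
    ... | yes pr = inj₂ (Any.reverse⁺ (keeps (complete t) pr))
    ... | no ¬pr = inj₁ (unswapped a b (λ { refl → ¬pr (inj₁ a) }) (λ { refl → ¬pr (inj₂ a) }))

    runE = OQ.run-star run star
    runD : Runs.RunFrom _≺′_ [] (as ++ bs)
    runD = Runs.join-run _≺′_ as (run-change (OQ.run-++⁻ˡ as runE) as-order)
                                 (run-change (OQ.split-run as runE) bs-order)

    words : OP.word (map g (as ++ bs)) ≡ OQ.word (as ++ bs)
    words = trans (sym (map-∘ (as ++ bs))) (map-cong
      (λ x → trans (sym (πTE (g x))) (cong E.πT (IT.strictlyInverseˡ x))) (as ++ bs))

  swaps-run : ∀ {P Q vs} → _≡₁*_ N P Q → CompleteRun Q vs →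
    ∃ λ ws → CompleteRun P ws × _≡₀*_ N (Occurrences.word P ws) (Occurrences.word Q vs)
  swaps-run {vs = vs} ε c = vs , c , ε
  swaps-run {P} {Q} (_◅_ {j = R} s ss) c with swaps-run {R} {Q} ss c
  ... | xs , c₁ , adj₁ with swap-run {P} {R} s c₁
  ... | ws , c₂ , adj₂ = ws , c₂ , adj₂ ◅◅ adj₁

-- Canonical processes

indicator : {A : Set} → Dec A → ℕ
indicator (yes _) = 1
indicator (no _)  = 0

indicator⁺ : {A : Set} (d : Dec A) → A → indicator d ≡ 1
indicator⁺ (yes _) _ = refl
indicator⁺ (no n)  a = ⊥-elim (n a)

indicator⁻ : {A : Set} (d : Dec A) → 1 ≤ indicator d → A
indicator⁻ (yes a) _ = a

indicator-no : {A : Set} (d : Dec A) → ¬ A → indicator d ≡ 0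
indicator-no (yes a) n = ⊥-elim (n a)
indicator-no (no _)  _ = refl

indicator≤1 : {A : Set} (d : Dec A) → indicator d ≤ 1
indicator≤1 (yes _) = s≤s z≤n
indicator≤1 (no _)  = z≤n

sum-zeros : {A : Set} (w : A → ℕ) (l : List A) → (∀ {x} → x ∈ l → w x ≡ 0) → sum (map w l) ≡ 0
sum-zeros w [] _ = refl
sum-zeros w (x ∷ l) z = cong₂ _+_ (z (here refl)) (sum-zeros w l (z ∘ there))

sum-filter : {A : Set} (w : A → ℕ) (l : List A) → sum (map w (filter (λ x → 1 ≤? w x) l)) ≡ sum (map w l)
sum-filter w [] = refl
sum-filter w (x ∷ l) with w x in eq
... | zero  = sum-filter w l
... | suc n = cong₂ _+_ eq (sum-filter w l)

sum-positive : {A : Set} (w : A → ℕ) (l : List A) → 1 ≤ sum (map w l) → ∃ λ x → x ∈ l × 1 ≤ w x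
sum-positive w (x ∷ l) p with w x in eq
... | suc _ = x , here refl , subst (1 ≤_) (sym eq) (s≤s z≤n)
... | zero  = let (y , m , q) = sum-positive w l p in y , there m , q

sum-member : {A : Set} (w : A → ℕ) {l : List A} {x : A} → x ∈ l → w x ≤ sum (map w l)
sum-member w (here refl) = m≤m+n _ _
sum-member w {y ∷ _} (there m) = ≤-trans (sum-member w m) (m≤n+m _ (w y))

-- Lookup as a relation on plain numbers: a position keeps its meaning when the list is mapped or
-- extended, without casts between `Fin` types.
data At {A : Set} : List A → ℕ → A → Set where
  here  : ∀ {x xs} → At (x ∷ xs) 0 x
  there : ∀ {x y xs j} → At xs j y → At (x ∷ xs) (suc j) y

at-lookup : {A : Set} (xs : List A) (i : Fin (length xs)) → At xs (toℕ i) (lookup xs i)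
at-lookup (x ∷ xs) Fin.zero    = here
at-lookup (x ∷ xs) (Fin.suc i) = there (at-lookup xs i)

at-fun : {A : Set} {xs : List A} {j : ℕ} {x y : A} → At xs j x → At xs j y → x ≡ y
at-fun here here = refl
at-fun (there a) (there b) = at-fun a b

at-snoc : {A : Set} (xs : List A) {y : A} {j : ℕ} {x : A} → At (xs ++ y ∷ []) j x → At xs j x ⊎ (j ≡ length xs × x ≡ y)
at-snoc [] here = inj₂ (refl , refl)
at-snoc (_ ∷ xs) here = inj₁ here
at-snoc (_ ∷ xs) (there a) with at-snoc xs a
... | inj₁ b = inj₁ (there b)
... | inj₂ (refl , e) = inj₂ (refl , e)

at-< : {A : Set} {xs : List A} {j : ℕ} {x : A} → At xs j x → j < length xs
at-< here = s≤s z≤n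
at-< (there a) = s≤s (at-< a)

at-any : {A : Set} (xs : List A) {j : ℕ} → j < length xs → ∃ λ x → At xs j x
at-any (x ∷ xs) {zero} _ = x , here
at-any (x ∷ xs) {suc j} (s≤s p) = let (y , a) = at-any xs p in y , there a

at-map⁻ : {A B : Set} (f : A → B) (xs : List A) {j : ℕ} {y : B} → At (map f xs) j y → ∃ λ x → At xs j x × f x ≡ y
at-map⁻ f (x ∷ xs) here = x , here , refl
at-map⁻ f (x ∷ xs) (there a) = let (z , b , e) = at-map⁻ f xs a in z , there b , e

-- A token of a canonical process records its birth (0 if it is initial, i + 1 if it is produced
-- by the transition at position i) and the position of the transition consuming it, if any.
Token : Set
Token = ℕ × Maybe ℕ

consumedBy : ℕ → Token → ℕ
consumedBy j (_ , c) = indicator (≡-dec _≟_ c (just j))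

bornAt : ℕ → Token → ℕ
bornAt i (b , _) = indicator (b ≟ i)

-- Since a birth is one more than the producing position, `b ≤ j` says that production strictly
-- precedes consumption.
Valid : ℕ → Token → Set
Valid n (b , c) = ∀ j → c ≡ just j → b ≤ j × j < n

tabulate-seq : ∀ k n (f : Fin n → ℕ) → (∀ i → f i ≡ k + toℕ i) → tabulate f ≡ seq k n
tabulate-seq k zero f e = refl
tabulate-seq k (suc n) f e = cong₂ _∷_ (trans (e Fin.zero) (+-identityʳ k))
  (tabulate-seq (suc k) n (f ∘ Fin.suc) λ i → trans (e (Fin.suc i)) (+-suc k (toℕ i)))

module Schedules (N : Net) where
  open Net N
  open Firing N
  open Prefixes N

  births : ℕ → S → List T → List ℕ
  births i s []      = []
  births i s (t ∷ σ) = replicate (post t s) (suc i) ++ births (suc i) s σ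

  allBirths : S → List T → List ℕ
  allBirths s σ = replicate (M0 s) 0 ++ births 0 s σ

  ∈-replicate⁻ : ∀ {A : Set} {x y : A} k → x ∈ replicate k y → x ≡ y
  ∈-replicate⁻ (suc k) (here e) = e
  ∈-replicate⁻ (suc k) (there m) = ∈-replicate⁻ k m

  births-range : ∀ i s σ {b} → b ∈ births i s σ → i < b × b ≤ i + length σ
  births-range i s (t ∷ σ) {b} m with ∈-++⁻ (replicate (post t s) (suc i)) m
  ... | inj₁ m′ rewrite ∈-replicate⁻ (post t s) m′ = ≤-refl , subst (suc i ≤_) (sym (+-suc i _)) (s≤s (m≤m+n i _))
  ... | inj₂ m′ = let (p , q) = births-range (suc i) s σ m′ in <-trans ≤-refl p , subst (b ≤_) (sym (+-suc i _)) q

  allBirths-range : ∀ s σ {b} → b ∈ allBirths s σ → b ≤ length σ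
  allBirths-range s σ m with ∈-++⁻ (replicate (M0 s) 0) m
  ... | inj₁ m′ rewrite ∈-replicate⁻ (M0 s) m′ = z≤n
  ... | inj₂ m′ = proj₂ (births-range 0 s σ m′)

  private
    is : ℕ → ℕ → ℕ
    is v b = indicator (b ≟ v)

    count-++ : ∀ v xs ys → sum (map (is v) (xs ++ ys)) ≡ sum (map (is v) xs) + sum (map (is v) ys)
    count-++ v xs ys = trans (cong sum (map-++ (is v) xs ys)) (sum-++ (map (is v) xs) _)

    count-same : ∀ v k → sum (map (is v) (replicate k v)) ≡ k
    count-same v k = trans (sum-ones (is v) (replicate k v) (λ m → indicator⁺ (_ ≟ v) (∈-replicate⁻ k m))) (length-replicate k)

    count-none : ∀ v xs → (∀ {b} → b ∈ xs → b ≢ v) → sum (map (is v) xs) ≡ 0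
    count-none v xs h = sum-zeros (is v) xs (λ m → indicator-no (_ ≟ v) (h m))

  count-births : ∀ i s σ {j t} → At σ j t → sum (map (is (suc (i + j))) (births i s σ)) ≡ post t s
  count-births i s (t ∷ σ) here rewrite +-identityʳ i =
    trans (count-++ (suc i) (replicate (post t s) (suc i)) _) (trans (cong₂ _+_ (count-same (suc i) (post t s))
      (count-none (suc i) (births (suc i) s σ) λ m → λ { refl → <-irrefl refl (proj₁ (births-range (suc i) s σ m)) })) (+-identityʳ _))
  count-births i s (t ∷ σ) {suc j} (there a) rewrite +-suc i j =
    trans (count-++ (suc (suc (i + j))) (replicate (post t s) (suc i)) _) (cong₂ _+_
      (count-none (suc (suc (i + j))) (replicate (post t s) (suc i)) λ m e → m≢1+m+n i (suc-injective (trans (sym (∈-replicate⁻ (post t s) m)) e)))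
      (count-births (suc i) s σ a))

  count-initial : ∀ s σ → sum (map (is 0) (allBirths s σ)) ≡ M0 s
  count-initial s σ = trans (count-++ 0 (replicate (M0 s) 0) _) (trans (cong₂ _+_ (count-same 0 (M0 s))
    (count-none 0 (births 0 s σ) λ { m refl → n≮0 (proj₁ (births-range 0 s σ m)) })) (+-identityʳ _))

  count-produced : ∀ s σ {j t} → At σ j t → sum (map (is (suc j)) (allBirths s σ)) ≡ post t s
  count-produced s σ {j} a = trans (count-++ (suc j) (replicate (M0 s) 0) _)
    (cong₂ _+_ (count-none (suc j) (replicate (M0 s) 0) (λ m e → 0≢1+n (trans (sym (∈-replicate⁻ (M0 s) m)) e))) (count-births 0 s σ a))

  Rows : Set
  Rows = S → List Token

  -- `uses` speaks only of positions inside `σ`; `valid` excludes consumers at any other position.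
  record Schedule (σ : List T) (r : Rows) : Set where
    field
      born  : ∀ s → map proj₁ (r s) ≡ allBirths s σ
      uses  : ∀ s {j t} → At σ j t → sum (map (consumedBy j) (r s)) ≡ pre s t
      valid : ∀ s → All (Valid (length σ)) (r s)

  module _ (σ : List T) (r : Rows) where
    Place : Set
    Place = Σ S λ s → Fin (length (r s))

    token : Place → Token
    token (s , k) = lookup (r s) k

    canonicalData : ProcData N
    canonicalData = record
      { 𝒮 = Place
      ; 𝒯 = Fin (length σ)
      ; pre𝒩 = λ p i → consumedBy (toℕ i) (token p)
      ; post𝒩 = λ i p → bornAt (suc (toℕ i)) (token p)
      ; m0 = λ p → bornAt 0 (token p)
      ; πS = proj₁
      ; πT = lookup σ
      }

    -- The three cardinality axioms for `π` are the instances where `w` is a `bornAt` or a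
    -- `consumedBy`.
    tokens-size : ∀ (w : Token → ℕ) s → MSize (w ∘ token) (λ p → proj₁ p ≡ s × 1 ≤ w (token p)) (sum (map w (r s)))
    tokens-size w s = map (s ,_) ks , Unique.map⁺ (λ { refl → refl }) (Unique.filter⁺ _ (Unique.allFin⁺ _)) ,
      (λ p → mk⇔ to from) , total
      where
      w′ : Fin (length (r s)) → ℕ
      w′ k = w (lookup (r s) k)
      ks = filter (λ k → 1 ≤? w′ k) (allFin _)
      to : ∀ {p} → p ∈ map (s ,_) ks → proj₁ p ≡ s × 1 ≤ w (token p)
      to m with ∈-map⁻ (s ,_) m
      ... | k , m′ , refl = refl , proj₂ (∈-filter⁻ (λ k → 1 ≤? w′ k) {xs = allFin _} m′)
      from : ∀ {p} → proj₁ p ≡ s × 1 ≤ w (token p) → p ∈ map (s ,_) ks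
      from {_ , k} (refl , a) = ∈-map⁺ (s ,_) (∈-filter⁺ (λ k → 1 ≤? w′ k) (∈-allFin k) a)
      total : sum (map (w ∘ token) (map (s ,_) ks)) ≡ sum (map w (r s))
      total = begin
        sum (map (w ∘ token) (map (s ,_) ks))    ≡⟨ cong sum (map-∘ ks) ⟨
        sum (map w′ ks)                          ≡⟨ sum-filter w′ (allFin _) ⟩
        sum (map w′ (allFin _))                  ≡⟨ cong sum (map-tabulate id w′) ⟩
        sum (tabulate w′)                        ≡⟨ cong sum (map-tabulate (lookup (r s)) w) ⟨
        sum (map w (tabulate (lookup (r s))))    ≡⟨ cong (sum ∘ map w) (tabulate-lookup (r s)) ⟩
        sum (map w (r s))                        ∎
        where open ≡-Reasoning

    module _ (sch : Schedule σ r) where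
      open Schedule sch
      open ProcData canonicalData

      token∈ : ∀ (p : Place) → token p ∈ r (proj₁ p)
      token∈ (s , k) = ∈-lookup {xs = r s} k

      birth : Place → ℕ
      birth p = proj₁ (token p)

      birth-range : ∀ p → birth p ≤ length σ
      birth-range p@(s , k) = allBirths-range s σ (subst (birth p ∈_) (born s) (∈-map⁺ proj₁ (token∈ p)))

      consumer : ∀ {p i} → 1 ≤ pre𝒩 p i → proj₂ (token p) ≡ just (toℕ i)
      consumer {p} {i} = indicator⁻ (≡-dec _≟_ (proj₂ (token p)) (just (toℕ i)))
      producer : ∀ {p i} → 1 ≤ post𝒩 i p → birth p ≡ suc (toℕ i)
      producer {p} {i} = indicator⁻ (birth p ≟ suc (toℕ i))

      birth≤consumer : ∀ {p i} → 1 ≤ pre𝒩 p i → birth p ≤ toℕ i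
      birth≤consumer {p} {i} a = proj₁ (All.lookup (valid (proj₁ p)) (token∈ p) (toℕ i) (consumer {p} a))

      private
        -- Firing i takes place between birth times i and i + 1.
        height : Node → ℕ
        height (inj₁ p) = birth p + birth p
        height (inj₂ i) = suc (toℕ i + toℕ i)

        edge-< : ∀ {x y} → Edge x y → height x < height y
        edge-< {inj₁ p} {inj₂ i} a = s≤s (+-mono-≤ (birth≤consumer {p} a) (birth≤consumer {p} a))
        edge-< {inj₂ i} {inj₁ p} a rewrite producer {p} {i} a = s≤s (subst (suc (toℕ i + toℕ i) ≤_) (sym (+-suc (toℕ i) _)) ≤-refl)

        plus-< : ∀ {x y} → Plus x y → height x < height y
        plus-< [ e ] = edge-< e
        plus-< (e ∷ p) = <-trans (edge-< e) (plus-< p)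

      plus-birth : ∀ {i p} → Plus (inj₂ i) (inj₁ p) → toℕ i < birth p
      plus-birth {i} {p} q with toℕ i <? birth p
      ... | yes lt = lt
      ... | no n = ⊥-elim (<⇒≱ (plus-< q) (m≤n⇒m≤1+n (+-mono-≤ (≮⇒≥ n) (≮⇒≥ n))))

      weight-sum : ∀ v s → sum (map (bornAt v) (r s)) ≡ sum (map (is v) (allBirths s σ))
      weight-sum v s = trans (cong sum (map-∘ (r s))) (cong (sum ∘ map (is v)) (born s))

      inputs-size : ∀ i s → MSize (λ p → pre𝒩 p i) (λ p → πS p ≡ s × 1 ≤ pre𝒩 p i) (pre s (πT i))
      inputs-size i s = subst (MSize _ _) (uses s (at-lookup σ i)) (tokens-size (consumedBy (toℕ i)) s)

      outputs-size : ∀ i s → MSize (λ p → post𝒩 i p) (λ p → πS p ≡ s × 1 ≤ post𝒩 i p) (post (πT i) s)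
      outputs-size i s = subst (MSize _ _) (trans (weight-sum (suc (toℕ i)) s) (count-produced s σ (at-lookup σ i)))
        (tokens-size (bornAt (suc (toℕ i))) s)

      private
        -- Only finitely many labels allow a positive weight, and each of them has a finite row.
        finite-by-label : ∀ {w : Place → ℕ} {v : S → ℕ} → Finite (λ s → 1 ≤ v s) →
          (∀ p → w p ≤ v (proj₁ p)) → Finite (λ p → 1 ≤ w p)
        finite-by-label (l , has) le = concatMap (λ s → map (s ,_) (allFin _)) l , λ p a →
          ∈-concatMap⁺ (λ s → map (s ,_) (allFin _)) (lose (has (proj₁ p) (≤-trans a (le p))) (∈-map⁺ (_ ,_) (∈-allFin (proj₂ p))))

      isGR : IsGR N canonicalData
      isGR = record
        { preFin𝒩 = λ i → finite-by-label (preFin (πT i)) λ p →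
            subst (pre𝒩 p i ≤_) (uses (proj₁ p) (at-lookup σ i)) (sum-member (consumedBy (toℕ i)) (token∈ p))
        ; preNE𝒩 = λ i → let (s , a) = preNE (πT i)
                             (l , _ , mem , total) = inputs-size i s
                             (p , _ , b) = sum-positive (λ p → pre𝒩 p i) l (subst (1 ≤_) (sym total) a)
                         in p , b
        ; postFin𝒩 = λ i → finite-by-label (postFin (πT i)) λ p →
            subst (post𝒩 i p ≤_) (trans (weight-sum (suc (toℕ i)) (proj₁ p)) (count-produced (proj₁ p) σ (at-lookup σ i)))
              (sum-member (bornAt (suc (toℕ i))) (token∈ p))
        ; inDeg = λ p → (λ i → indicator≤1 (birth p ≟ suc (toℕ i))) ,
            λ i j a b → toℕ-injective (suc-injective (trans (sym (producer {p} a)) (producer {p} b)))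
        ; outDeg = λ p → (λ i → indicator≤1 (≡-dec _≟_ (proj₂ (token p)) (just (toℕ i)))) ,
            λ i j a b → toℕ-injective (just-injective (trans (sym (consumer {p} a)) (consumer {p} b)))
        ; m0-empty = λ p none → indicator⁺ (birth p ≟ 0) (unproduced p none)
        ; m0-nonempty = λ p some → indicator-no (birth p ≟ 0) λ e →
            some λ i → indicator-no (birth p ≟ suc (toℕ i)) λ e′ → 0≢1+n (trans (sym e) e′)
        ; acyclic = λ x p → <-irrefl refl (plus-< p)
        ; finPred = λ u → allFin _ , λ t _ → ∈-allFin t
        ; π-M0 = λ s → subst (MSize _ _) (trans (weight-sum 0 s) (count-initial s σ)) (tokens-size (bornAt 0) s)
        ; π-pre = inputs-size
        ; π-post = outputs-size
        }
        where
        unproduced : ∀ p → (∀ i → post𝒩 i p ≡ 0) → birth p ≡ 0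
        unproduced p none = from (birth p) refl
          where
          from : ∀ b → birth p ≡ b → birth p ≡ 0
          from zero e = e
          from (suc b) e = ⊥-elim (0≢1+n (trans (sym (none (fromℕ< b<)))
            (indicator⁺ (birth p ≟ _) (trans e (cong suc (sym (toℕ-fromℕ< b<)))))))
            where
            b< : b < length σ
            b< = subst (_≤ length σ) e (birth-range p)

      canonical : Process N
      canonical = canonicalData , isGR

      canonical-finite : FiniteP N canonical
      canonical-finite = allFin _ , λ t _ → ∈-allFin t

      open Occurrences canonical using (RunFrom; Precedes; word)

      precedes-< : ∀ {i j} → Precedes i j → toℕ i < toℕ j
      precedes-< {i} {j} (p , a , b) = subst (_≤ toℕ j) (producer {p} a) (birth≤consumer {p} b)

      canonical-run : RunFrom [] (allFin _)
      canonical-run = run-seq toℕ toℕ-injective precedes-< 0 (length σ) (allFin _)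
        (trans (map-tabulate id toℕ) (tabulate-seq 0 _ _ λ i → refl)) (λ ()) (λ ())

      canonical-word : word (allFin _) ≡ σ
      canonical-word = trans (map-tabulate id (lookup σ)) (tabulate-lookup σ)

-- Canonical prefixes of an arbitrary process

indicator-≡ : {A : Set} (d : Dec A) {n : ℕ} → n ≤ 1 → (A → 1 ≤ n) → (1 ≤ n → A) → indicator d ≡ n
indicator-≡ (yes a) n≤1 to _ = ≤-antisym (to a) n≤1
indicator-≡ (no k) {zero} _ _ _ = refl
indicator-≡ (no k) {suc n} _ _ from = ⊥-elim (k (from (s≤s z≤n)))

module _ {A B : Set} (f : A → B) where
  -- Reads an index of `map f xs` in `xs` itself, which saves casting along the equality of lengths.
  pick : (xs : List A) → Fin (length (map f xs)) → A
  pick (x ∷ xs) Fin.zero    = x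
  pick (x ∷ xs) (Fin.suc k) = pick xs k

  lookup-pick : ∀ xs k → lookup (map f xs) k ≡ f (pick xs k)
  lookup-pick (x ∷ xs) Fin.zero    = refl
  lookup-pick (x ∷ xs) (Fin.suc k) = lookup-pick xs k

  pick-∈ : ∀ xs k → pick xs k ∈ xs
  pick-∈ (x ∷ xs) Fin.zero    = here refl
  pick-∈ (x ∷ xs) (Fin.suc k) = there (pick-∈ xs k)

  pick-at : ∀ xs k → At xs (toℕ k) (pick xs k)
  pick-at (x ∷ xs) Fin.zero    = here
  pick-at (x ∷ xs) (Fin.suc k) = there (pick-at xs k)

  pick-onto : ∀ {xs y} → y ∈ xs → ∃ λ k → pick xs k ≡ y
  pick-onto (here e)  = Fin.zero , sym e
  pick-onto (there m) = let (k , e) = pick-onto m in Fin.suc k , e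

  pick-injective : ∀ {C : Set} (g : A → C) {xs} → Unique (map g xs) → ∀ {k l} →
    g (pick xs k) ≡ g (pick xs l) → k ≡ l
  pick-injective g {x ∷ xs} (n ∷ u) {Fin.zero}  {Fin.zero}  e = refl
  pick-injective g {x ∷ xs} (n ∷ u) {Fin.zero}  {Fin.suc l} e = ⊥-elim (All.lookup n (∈-map⁺ g (pick-∈ xs l)) e)
  pick-injective g {x ∷ xs} (n ∷ u) {Fin.suc k} {Fin.zero}  e = ⊥-elim (All.lookup n (∈-map⁺ g (pick-∈ xs k)) (sym e))
  pick-injective g {x ∷ xs} (n ∷ u) {Fin.suc k} {Fin.suc l} e = cong Fin.suc (pick-injective g u e)

at-∈ : {A : Set} {xs : List A} {j : ℕ} {x : A} → At xs j x → x ∈ xs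
at-∈ here = here refl
at-∈ (there a) = there (at-∈ a)

at-injective : {A : Set} {xs : List A} {i j : ℕ} {x : A} → Unique xs → At xs i x → At xs j x → i ≡ j
at-injective (n ∷ u) here here = refl
at-injective (n ∷ u) here (there b) = ⊥-elim (All.lookup n (at-∈ b) refl)
at-injective (n ∷ u) (there a) here = ⊥-elim (All.lookup n (at-∈ a) refl)
at-injective (n ∷ u) (there a) (there b) = cong suc (at-injective u a b)

run-at : {A : Set} {_≺_ : A → A → Set} → ∀ {d xs j x y} → Runs.RunFrom _≺_ d xs → At xs j x → y ≺ x →
  y ∈ d ⊎ ∃ λ i → i < j × At xs i y
run-at (Runs.run∷ _ p _) here y≺x = inj₁ (p y≺x)
run-at (Runs.run∷ _ _ r) (there a) y≺x with run-at r a y≺x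
... | inj₁ (here refl) = inj₂ (0 , s≤s z≤n , here)
... | inj₁ (there m) = inj₁ m
... | inj₂ (i , lt , b) = inj₂ (suc i , s≤s lt , there b)

map-const : {A B : Set} (c : B) (xs : List A) → map (λ _ → c) xs ≡ replicate (length xs) c
map-const c [] = refl
map-const c (x ∷ xs) = cong (c ∷_) (map-const c xs)

module Unfolding (N : Net) (P : Process N) where
  open Net N
  open Firing N
  open Prefixes N
  open Schedules N
  open ProcData (proj₁ P)
  open IsGR (proj₂ P)
  open Occurrences P

  -- The consumer is sought within the run only; a place consumed later in `P` counts as free.
  search : List 𝒯 → 𝒮 → Maybe ℕ
  search [] x = nothing
  search (t ∷ ts) x with 1 ≤? pre𝒩 x t
  ... | yes _ = just 0
  ... | no _  = Data.Maybe.map suc (search ts x)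

  search-sound : ∀ ts {x j} → search ts x ≡ just j → ∃ λ t → At ts j t × 1 ≤ pre𝒩 x t
  search-sound (t ∷ ts) {x} e with 1 ≤? pre𝒩 x t
  search-sound (t ∷ ts) {x} refl | yes a = t , here , a
  search-sound (t ∷ ts) {x} e | no _ with search ts x in eq
  search-sound (t ∷ ts) {x} refl | no _ | just j = let (u , at , a) = search-sound ts eq in u , there at , a

  search-complete : ∀ {ts x j t} → Unique ts → At ts j t → 1 ≤ pre𝒩 x t → search ts x ≡ just j
  search-complete {t ∷ ts} {x} u at a with 1 ≤? pre𝒩 x t
  search-complete u here a | yes _ = refl
  search-complete {t ∷ ts} {x} {t = t′} (n ∷ _) (there at) a | yes b = ⊥-elim (All.lookup n (at-∈ at) (proj₂ (outDeg x) t t′ b a))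
  search-complete u here a | no k = ⊥-elim (k a)
  search-complete (_ ∷ u) (there at) a | no _ rewrite search-complete u at a = refl

  outs : ℕ → S → List 𝒯 → List (ℕ × 𝒮)
  outs i s []       = []
  outs i s (t ∷ ts) = map (suc i ,_) (outputs s t) ++ outs (suc i) s ts

  tagged : List 𝒯 → S → List (ℕ × 𝒮)
  tagged ts s = map (0 ,_) (initial s) ++ outs 0 s ts

  Origin : List 𝒯 → ℕ → 𝒮 → Set
  Origin ts b x = (b ≡ 0 × 1 ≤ m0 x) ⊎ ∃₂ λ i t → b ≡ suc i × At ts i t × 1 ≤ post𝒩 t x

  outs-origin : ∀ i s ts {b x} → (b , x) ∈ outs i s ts →
    πS x ≡ s × ∃₂ λ j t → b ≡ suc (i + j) × At ts j t × 1 ≤ post𝒩 t x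
  outs-origin i s (t ∷ ts) m with ∈-++⁻ (map (suc i ,_) (outputs s t)) m
  ... | inj₁ m′ with ∈-map⁻ (suc i ,_) m′
  ... | x , k , refl = let (e , a) = ∈-outputs⁻ k in e , 0 , t , cong suc (sym (+-identityʳ i)) , here , a
  outs-origin i s (t ∷ ts) m | inj₂ m′ with outs-origin (suc i) s ts m′
  ... | e , j , u , refl , at , a = e , suc j , u , cong suc (sym (+-suc i j)) , there at , a

  tagged-origin : ∀ {ts s b x} → (b , x) ∈ tagged ts s → πS x ≡ s × Origin ts b x
  tagged-origin {ts} {s} m with ∈-++⁻ (map (0 ,_) (initial s)) m
  ... | inj₁ m′ with ∈-map⁻ (0 ,_) m′
  ... | x , k , refl = let (e , a) = ∈-initial⁻ k in e , inj₁ (refl , a)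
  tagged-origin {ts} {s} m | inj₂ m′ with outs-origin 0 s ts m′
  ... | e , j , t , q = e , inj₂ (j , t , q)

  places : List 𝒯 → S → List 𝒮
  places ts s = initial s ++ concatMap (outputs s) ts

  tagged-places : ∀ ts s → map proj₂ (tagged ts s) ≡ places ts s
  tagged-places ts s = trans (map-++ proj₂ (map (0 ,_) (initial s)) _)
    (cong₂ _++_ (untag 0 (initial s)) (untag-outs 0 ts))
    where
    untag : ∀ i (xs : List 𝒮) → map proj₂ (map (i ,_) xs) ≡ xs
    untag i xs = trans (sym (map-∘ xs)) (map-id xs)
    untag-outs : ∀ i ts → map proj₂ (outs i s ts) ≡ concatMap (outputs s) ts
    untag-outs i [] = refl
    untag-outs i (t ∷ ts) = trans (map-++ proj₂ (map (suc i ,_) (outputs s t)) _)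
      (cong₂ _++_ (untag (suc i) (outputs s t)) (untag-outs (suc i) ts))

  unique-places : ∀ {ts} s → Unique ts → Unique (places ts s)
  unique-places {ts} s uniq = Unique.++⁺ (proj₁ (proj₂ (π-M0 s))) (outs-unique uniq)
    λ { (m , m′) → let (t , _ , a) = made-by {ts} m′ in <-irrefl (sym (produced⇒m0≡0 a)) (proj₂ (∈-initial⁻ m)) }
    where
    made-by : ∀ {ts p} → p ∈ concatMap (outputs s) ts → ∃ λ t → t ∈ ts × 1 ≤ post𝒩 t p
    made-by {ts} m = let (t , k , a) = find (∈-concatMap⁻ (outputs s) {xs = ts} m) in t , k , proj₂ (∈-outputs⁻ a)
    outs-unique : ∀ {ts} → Unique ts → Unique (concatMap (outputs s) ts)
    outs-unique [] = []
    outs-unique {t ∷ ts} (n ∷ u) = Unique.++⁺ (proj₁ (proj₂ (π-post t s))) (outs-unique u)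
      λ { (m , m′) → let (t′ , k , a) = made-by {ts} m′
                     in All.lookup n k (proj₂ (inDeg _) t t′ (proj₂ (∈-outputs⁻ m)) a) }

  ∈-tagged : ∀ {ts x} → 1 ≤ m0 x ⊎ (∃ λ t → t ∈ ts × 1 ≤ post𝒩 t x) → ∃ λ b → (b , x) ∈ tagged ts (πS x)
  ∈-tagged {ts} {x} o with ∈-map⁻ proj₂ (subst (x ∈_) (sym (tagged-places ts (πS x))) (from o))
    where
    from : 1 ≤ m0 x ⊎ (∃ λ t → t ∈ ts × 1 ≤ post𝒩 t x) → x ∈ places ts (πS x)
    from (inj₁ a) = ∈-++⁺ˡ (∈-initial⁺ refl a)
    from (inj₂ (t , m , a)) = ∈-++⁺ʳ (initial (πS x)) (∈-concatMap⁺ (outputs (πS x)) (lose m (∈-outputs⁺ refl a)))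
  ... | (b , x) , m , refl = b , m

  module _ {ts : List 𝒯} (run : RunFrom [] ts) where
    private
      uniq = run-unique run

      tokenOf : ℕ × 𝒮 → Token
      tokenOf (b , x) = b , search ts x

      before : ∀ {j t u} → At ts j u → Precedes t u → ∃ λ i → i < j × At ts i t
      before at p with run-at run at p
      ... | inj₂ q = q

    rows : Rows
    rows s = map tokenOf (tagged ts s)

    private
      consumedBy-pre : ∀ {j t} b x → At ts j t → consumedBy j (tokenOf (b , x)) ≡ pre𝒩 x t
      consumedBy-pre {j} {t} b x at = indicator-≡ (≡-dec _≟_ (search ts x) (just j)) (proj₁ (outDeg x) t)
        (λ e → let (u , at′ , a) = search-sound ts e in subst (λ z → 1 ≤ pre𝒩 x z) (at-fun at′ at) a)
        (search-complete uniq at)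

      rows-born : ∀ s → map proj₁ (rows s) ≡ allBirths s (word ts)
      rows-born s = trans (sym (map-∘ (tagged ts s))) (trans (map-++ proj₁ (map (0 ,_) (initial s)) _)
        (cong₂ _++_ (tags 0 (initial s) (length-initial s)) (tags-outs 0 ts)))
        where
        tags : ∀ i (xs : List 𝒮) {n} → length xs ≡ n → map proj₁ (map (i ,_) xs) ≡ replicate n i
        tags i xs refl = trans (sym (map-∘ xs)) (map-const i xs)
        tags-outs : ∀ i ts → map proj₁ (outs i s ts) ≡ births i s (word ts)
        tags-outs i [] = refl
        tags-outs i (t ∷ ts) = trans (map-++ proj₁ (map (suc i ,_) (outputs s t)) _)
          (cong₂ _++_ (tags (suc i) (outputs s t) (length-outputs s t)) (tags-outs (suc i) ts))

      rows-uses : ∀ s {j v} → At (word ts) j v → sum (map (consumedBy j) (rows s)) ≡ pre s v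
      rows-uses s {j} at with at-map⁻ πT ts at
      ... | t , at′ , refl = begin
        sum (map (consumedBy j) (rows s))                ≡⟨ cong sum (map-∘ (tagged ts s)) ⟨
        sum (map (consumedBy j ∘ tokenOf) (tagged ts s)) ≡⟨ cong sum (map-cong (λ (b , x) → consumedBy-pre b x at′) (tagged ts s)) ⟩
        sum (map (w ∘ proj₂) (tagged ts s))              ≡⟨ cong sum (map-∘ (tagged ts s)) ⟩
        sum (map w (map proj₂ (tagged ts s)))            ≡⟨ cong (sum ∘ map w) (tagged-places ts s) ⟩
        sum (map w (places ts s))                        ≡⟨ sum-filter w (places ts s) ⟨
        sum (map w l)                                    ≡⟨ sum-ones w l (λ m → ≤-antisym (proj₁ (outDeg _) t) (proj₂ (∈-filter⁻ w? {xs = places ts s} m))) ⟩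
        -- Both lists are duplicate-free with the same members. Every input of `t` occurs among
        -- `places` because the run puts its producer before `t`.
        length l                                         ≡⟨ ≤-antisym (unique-⊆-length (Unique.filter⁺ w? (unique-places s uniq)) l⊆)
                                                                      (unique-⊆-length (proj₁ (proj₂ (π-pre t s))) ⊆l) ⟩
        length (inputs s t)                              ≡⟨ length-inputs s t ⟩
        pre s (πT t)                                     ∎
        where
        open ≡-Reasoning
        w : 𝒮 → ℕ
        w x = pre𝒩 x t
        w? : ∀ x → Dec (1 ≤ w x)
        w? x = 1 ≤? w x
        l = filter w? (places ts s)
        label : ∀ {x} → x ∈ places ts s → πS x ≡ s
        label {x} m with ∈-map⁻ proj₂ (subst (x ∈_) (sym (tagged-places ts s)) m)
        ... | _ , m′ , refl = proj₁ (tagged-origin {ts} m′)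
        l⊆ : l ⊆ inputs s t
        l⊆ m = let (k , a) = ∈-filter⁻ w? {xs = places ts s} m in ∈-inputs⁺ (label k) a
        ⊆l : inputs s t ⊆ l
        ⊆l {x} m with ∈-inputs⁻ m
        ... | refl , a with ∈-tagged {ts} (origin {x} ts λ b → let (_ , _ , k) = before at′ (x , b , a) in at-∈ k)
        ... | b , k = ∈-filter⁺ w? (subst (x ∈_) (tagged-places ts s) (∈-map⁺ proj₂ k)) a

      rows-valid : ∀ s → All (Valid (length (word ts))) (rows s)
      rows-valid s = All.tabulate check
        where
        check : ∀ {y} → y ∈ rows s → Valid (length (word ts)) y
        check m j e with ∈-map⁻ tokenOf m
        ... | (b , x) , m′ , refl with search-sound ts e
        ... | u , at , a = early (proj₂ (tagged-origin m′)) , subst (j <_) (sym (length-map πT ts)) (at-< at)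
          where
          early : Origin ts b x → b ≤ j
          early (inj₁ (refl , _)) = z≤n
          early (inj₂ (i , t , refl , at′ , c)) with before at (x , c , a)
          -- The run gives producing position below `j`; with the shift in births this is literally
          -- the required bound.
          ... | i′ , lt , at″ rewrite at-injective uniq at′ at″ = lt

    schedule : Schedule (word ts) rows
    schedule = record { born = rows-born ; uses = rows-uses ; valid = rows-valid }

    private
      Q = canonical (word ts) rows schedule
      module Q = ProcData (proj₁ Q)

      placeOf : Q.𝒮 → 𝒮
      placeOf (s , k) = proj₂ (pick tokenOf (tagged ts s) k)

      birthOf : Q.𝒮 → ℕ
      birthOf (s , k) = proj₁ (lookup (rows s) k)

      placeOf-origin : ∀ p → πS (placeOf p) ≡ proj₁ p × Origin ts (birthOf p) (placeOf p)
      placeOf-origin (s , k) with tagged-origin {ts} {s} (pick-∈ tokenOf (tagged ts s) k)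
      ... | e , o = e , subst (λ b → Origin ts b (placeOf (s , k))) (sym (cong proj₁ (lookup-pick tokenOf (tagged ts s) k))) o

      placeOf-inj : ∀ {p q} → placeOf p ≡ placeOf q → p ≡ q
      placeOf-inj {p} {q} e = same p q (trans (sym (proj₁ (placeOf-origin p))) (trans (cong πS e) (proj₁ (placeOf-origin q)))) e
        where
        same : ∀ p q → proj₁ p ≡ proj₁ q → placeOf p ≡ placeOf q → p ≡ q
        same (s , k) (s , l) refl e = cong (s ,_)
          (pick-injective tokenOf proj₂ (subst Unique (sym (tagged-places ts s)) (unique-places s uniq)) e)

      placeOf-onto : ∀ {x} → 1 ≤ m0 x ⊎ (∃ λ t → t ∈ ts × 1 ≤ post𝒩 t x) → ∃ λ p → placeOf p ≡ x
      placeOf-onto {x} o with ∈-tagged {ts} o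
      ... | b , m with pick-onto tokenOf m
      ... | k , e = (πS x , k) , cong proj₂ e

      m0-eq : ∀ p → Q.m0 p ≡ m0 (placeOf p)
      m0-eq p = indicator-≡ (birthOf p ≟ 0) (m0≤1 _) (to (proj₂ (placeOf-origin p))) (from (proj₂ (placeOf-origin p)))
        where
        to : ∀ {b x} → Origin ts b x → b ≡ 0 → 1 ≤ m0 x
        to (inj₁ (_ , a)) _ = a
        to (inj₂ (_ , _ , refl , _)) ()
        from : ∀ {b x} → Origin ts b x → 1 ≤ m0 x → b ≡ 0
        from (inj₁ (e , _)) _ = e
        from (inj₂ (_ , _ , _ , _ , c)) a = ⊥-elim (<-irrefl (sym (produced⇒m0≡0 c)) a)

      pre-eq : ∀ p i → Q.pre𝒩 p i ≡ pre𝒩 (placeOf p) (pick πT ts i)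
      pre-eq (s , k) i = trans (cong (consumedBy (toℕ i)) (lookup-pick tokenOf (tagged ts s) k))
        (consumedBy-pre (proj₁ (pick tokenOf (tagged ts s) k)) _ (pick-at πT ts i))

      post-eq : ∀ i p → Q.post𝒩 i p ≡ post𝒩 (pick πT ts i) (placeOf p)
      post-eq i p = indicator-≡ (birthOf p ≟ suc (toℕ i)) (proj₁ (inDeg _) _) (to (proj₂ (placeOf-origin p))) (from (proj₂ (placeOf-origin p)))
        where
        t = pick πT ts i
        at = pick-at πT ts i
        to : ∀ {b x} → Origin ts b x → b ≡ suc (toℕ i) → 1 ≤ post𝒩 t x
        to (inj₁ (refl , _)) ()
        to {x = x} (inj₂ (_ , u , refl , at′ , c)) refl = subst (λ z → 1 ≤ post𝒩 z x) (at-fun at′ at) c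
        from : ∀ {b x} → Origin ts b x → 1 ≤ post𝒩 t x → b ≡ suc (toℕ i)
        from (inj₁ (_ , a)) c = ⊥-elim (<-irrefl (sym (produced⇒m0≡0 c)) a)
        from (inj₂ (j , u , refl , at′ , c′)) c with proj₂ (inDeg _) u t c′ c
        ... | refl = cong suc (at-injective uniq at′ at)

    -- A run spans a causally closed part of `P`, and `Q` is its canonical copy. In this way finite
    -- pieces are cut out of a possibly infinite process.
    embedding : _≤P_ N Q P
    embedding = record
      { ιS = placeOf ; ιT = pick πT ts ; ιS-inj = placeOf-inj
      ; ιT-inj = pick-injective πT id (subst Unique (sym (map-id ts)) uniq)
      ; m0-eq = m0-eq ; m0-sub = λ s a → placeOf-onto (inj₁ a)
      ; pre-eq = pre-eq ; post-eq = post-eq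
      ; πS-eq = λ p → sym (proj₁ (placeOf-origin p)) ; πT-eq = lookup-pick πT ts
      }

    embedding-place : ∀ {x} → 1 ≤ m0 x ⊎ (∃ λ t → t ∈ ts × 1 ≤ post𝒩 t x) → ∃ λ p → _≤P_.ιS embedding p ≡ x
    embedding-place = placeOf-onto

    embedding-transition : ∀ {t} → t ∈ ts → ∃ λ i → _≤P_.ιT embedding i ≡ t
    embedding-transition = pick-onto πT

-- Prolonging a canonical process

isFree : Token → ℕ
isFree (_ , nothing) = 1
isFree (_ , just _)  = 0

free : List Token → ℕ
free xs = sum (map isFree xs)

uses# : ℕ → List Token → ℕ
uses# j xs = sum (map (consumedBy j) xs)

-- Free tokens are taken oldest first. This greedy choice keeps a later transition off freshly made
-- tokens, which stand at the end of a row.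
claim : ℕ → ℕ → List Token → List Token
claim zero    n xs                   = xs
claim (suc k) n []                   = []
claim (suc k) n ((b , nothing) ∷ xs) = (b , just n) ∷ claim k n xs
claim (suc k) n ((b , just j) ∷ xs)  = (b , just j) ∷ claim (suc k) n xs

claim-born : ∀ k n xs → map proj₁ (claim k n xs) ≡ map proj₁ xs
claim-born zero n xs = refl
claim-born (suc k) n [] = refl
claim-born (suc k) n ((b , nothing) ∷ xs) = cong (b ∷_) (claim-born k n xs)
claim-born (suc k) n ((b , just j) ∷ xs) = cong (b ∷_) (claim-born (suc k) n xs)

claim-old : ∀ k {n j} xs → j ≢ n → uses# j (claim k n xs) ≡ uses# j xs
claim-old zero xs ne = refl
claim-old (suc k) [] ne = refl
claim-old (suc k) {n} {j} ((b , nothing) ∷ xs) ne =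
  cong₂ _+_ (indicator-no (≡-dec _≟_ (just n) (just j)) (ne ∘ sym ∘ just-injective)) (claim-old k xs ne)
claim-old (suc k) {n} {j} ((b , just i) ∷ xs) ne = cong (consumedBy j (b , just i) +_) (claim-old (suc k) xs ne)

claim-new : ∀ k n xs → k ≤ free xs → uses# n (claim k n xs) ≡ k + uses# n xs
claim-new zero n xs _ = refl
claim-new (suc k) n ((b , nothing) ∷ xs) (s≤s le) =
  cong₂ _+_ (indicator⁺ (≡-dec _≟_ (just n) (just n)) refl) (claim-new k n xs le)
claim-new (suc k) n ((b , just i) ∷ xs) le =
  trans (cong (consumedBy n (b , just i) +_) (claim-new (suc k) n xs le)) (shuffle (consumedBy n (b , just i)) (suc k) (uses# n xs))
  where
  shuffle : ∀ a b c → a + (b + c) ≡ b + (a + c)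
  shuffle = solve-∀

claim-free : ∀ k n xs → k ≤ free xs → k + free (claim k n xs) ≡ free xs
claim-free zero n xs _ = refl
claim-free (suc k) n ((b , nothing) ∷ xs) (s≤s le) = cong suc (claim-free k n xs le)
claim-free (suc k) n ((b , just i) ∷ xs) le = claim-free (suc k) n xs le

-- The claim is exhausted within `xs`. With `ys` the tokens just made by `t`, this is how `u` avoids
-- depending on `t`.
claim-++ : ∀ k n xs ys → k ≤ free xs → claim k n (xs ++ ys) ≡ claim k n xs ++ ys
claim-++ zero n xs ys _ = refl
claim-++ (suc k) n ((b , nothing) ∷ xs) ys (s≤s le) = cong (_ ∷_) (claim-++ k n xs ys le)
claim-++ (suc k) n ((b , just i) ∷ xs) ys le = cong (_ ∷_) (claim-++ (suc k) n xs ys le)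

claim-All : ∀ {Q Q′ : Token → Set} k {n} xs → (∀ {b} → Q (b , nothing) → Q′ (b , just n)) → (∀ {x} → Q x → Q′ x) →
  All Q xs → All Q′ (claim k n xs)
claim-All zero xs new old qs = All.map old qs
claim-All (suc k) [] new old [] = []
claim-All (suc k) ((b , nothing) ∷ xs) new old (q ∷ qs) = new q ∷ claim-All k xs new old qs
claim-All (suc k) ((b , just _) ∷ xs) new old (q ∷ qs) = old q ∷ claim-All (suc k) xs new old qs

-- A free token and one consumed at position `n` or later look alike to the first `n` transitions,
-- so a prefix embedding may relate them.
Same : ℕ → Token → Token → Set
Same n x y = proj₁ x ≡ proj₁ y × (∀ j → j < n → consumedBy j x ≡ consumedBy j y)

-- Additional tokens must not be initial, because a prefix has all initial places of the larger
-- process.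
data Extends (n : ℕ) : List Token → List Token → Set where
  []  : ∀ {ys} → All (λ y → proj₁ y ≢ 0) ys → Extends n [] ys
  _∷_ : ∀ {x y xs ys} → Same n x y → Extends n xs ys → Extends n (x ∷ xs) (y ∷ ys)

module _ {n : ℕ} where
  extends-index : ∀ {xs ys} → Extends n xs ys → Fin (length xs) → Fin (length ys)
  extends-index (_ ∷ e) Fin.zero    = Fin.zero
  extends-index (_ ∷ e) (Fin.suc k) = Fin.suc (extends-index e k)

  extends-same : ∀ {xs ys} (e : Extends n xs ys) k → Same n (lookup xs k) (lookup ys (extends-index e k))
  extends-same (s ∷ e) Fin.zero    = s
  extends-same (s ∷ e) (Fin.suc k) = extends-same e k

  extends-injective : ∀ {xs ys} (e : Extends n xs ys) {k l} → extends-index e k ≡ extends-index e l → k ≡ l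
  extends-injective (s ∷ e) {Fin.zero}  {Fin.zero}  _ = refl
  extends-injective (s ∷ e) {Fin.suc k} {Fin.suc l} q = cong Fin.suc (extends-injective e (Fin.suc-injective q))

  extends-initial : ∀ {xs ys} (e : Extends n xs ys) k → proj₁ (lookup ys k) ≡ 0 → ∃ λ l → extends-index e l ≡ k
  extends-initial {ys = ys} ([] none) k b = ⊥-elim (All.lookup none (∈-lookup {xs = ys} k) b)
  extends-initial (s ∷ e) Fin.zero b = Fin.zero , refl
  extends-initial (s ∷ e) (Fin.suc k) b = let (l , q) = extends-initial e k b in Fin.suc l , cong Fin.suc q

  extends-refl : ∀ {ys} xs → All (λ y → proj₁ y ≢ 0) ys → Extends n xs (xs ++ ys)
  extends-refl [] none = [] none
  extends-refl (x ∷ xs) none = (refl , λ _ _ → refl) ∷ extends-refl xs none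

  claim-extends : ∀ k {ys} xs → All (λ y → proj₁ y ≢ 0) ys → Extends n xs (claim k n xs ++ ys)
  claim-extends zero xs none = extends-refl xs none
  claim-extends (suc k) [] none = [] none
  claim-extends (suc k) ((b , nothing) ∷ xs) none = (refl , λ j j<n →
    sym (indicator-no (≡-dec _≟_ (just n) (just j)) (λ e → <-irrefl (sym (just-injective e)) j<n))) ∷ claim-extends k xs none
  claim-extends (suc k) ((b , just _) ∷ xs) none = (refl , λ _ _ → refl) ∷ claim-extends (suc k) xs none

inject++ : {A : Set} (xs : List A) {ys : List A} → Fin (length xs) → Fin (length (xs ++ ys))
inject++ (x ∷ xs) Fin.zero    = Fin.zero
inject++ (x ∷ xs) (Fin.suc k) = Fin.suc (inject++ xs k)

toℕ-inject++ : {A : Set} (xs : List A) {ys : List A} (k : Fin (length xs)) → toℕ (inject++ xs {ys} k) ≡ toℕ k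
toℕ-inject++ (x ∷ xs) Fin.zero    = refl
toℕ-inject++ (x ∷ xs) (Fin.suc k) = cong suc (toℕ-inject++ xs k)

lookup-inject++ : {A : Set} (xs : List A) {ys : List A} (k : Fin (length xs)) → lookup xs k ≡ lookup (xs ++ ys) (inject++ xs k)
lookup-inject++ (x ∷ xs) Fin.zero    = refl
lookup-inject++ (x ∷ xs) (Fin.suc k) = lookup-inject++ xs k

second-injective : {A : Set} {B : A → Set} {a : A} {b c : B a} → _≡_ {A = Σ A B} (a , b) (a , c) → b ≡ c
second-injective refl = refl

sum-map-+ : {A : Set} (f g : A → ℕ) (l : List A) → sum (map (λ x → f x + g x) l) ≡ sum (map f l) + sum (map g l)
sum-map-+ f g [] = refl
sum-map-+ f g (x ∷ l) = trans (cong (f x + g x +_) (sum-map-+ f g l)) (shuffle (f x) (g x) _ _)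
  where
  shuffle : ∀ a b c d → a + b + (c + d) ≡ a + c + (b + d)
  shuffle = solve-∀

∈-seq : ∀ {v} i n → v ∈ seq i n → i ≤ v
∈-seq i (suc n) (here refl) = ≤-refl
∈-seq i (suc n) (there m) = ≤-trans (n≤1+n i) (∈-seq (suc i) n m)

count-seq : ∀ v i n {b} → i ≤ v → v < i + n → sum (map (λ j → consumedBy j (b , just v)) (seq i n)) ≡ 1
count-seq v i zero i≤v v< = ⊥-elim (<⇒≱ v< (subst (_≤ v) (sym (+-identityʳ i)) i≤v))
count-seq v i (suc n) {b} i≤v v< with m≤n⇒m<n∨m≡n i≤v
... | inj₁ i<v = cong₂ _+_ (indicator-no (≡-dec _≟_ (just v) (just i)) (λ e → <-irrefl (sym (just-injective e)) i<v))
                           (count-seq v (suc i) n {b} i<v (subst (v <_) (+-suc i n) v<))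
... | inj₂ refl = cong₂ _+_ (indicator⁺ (≡-dec _≟_ (just i) (just i)) refl)
  (sum-zeros (λ j → consumedBy j (b , just i)) (seq (suc i) n)
    λ {j} m → indicator-no (≡-dec _≟_ (just i) (just j)) (λ e → <-irrefl (just-injective e) (∈-seq (suc i) n m)))

-- A valid token is either free or consumed at exactly one of the positions below `n`, so each token
-- contributes one to the left side.
free-uses : ∀ n xs → All (Valid n) xs → free xs + sum (map (λ j → uses# j xs) (seq 0 n)) ≡ length xs
free-uses n [] _ = sum-zeros (λ _ → 0) (seq 0 n) (λ _ → refl)
free-uses n (x@(b , c) ∷ xs) (v ∷ vs) = begin
  (isFree x + free xs) + sum (map (λ j → consumedBy j x + uses# j xs) (seq 0 n))
    ≡⟨ cong (isFree x + free xs +_) (sum-map-+ (λ j → consumedBy j x) (λ j → uses# j xs) (seq 0 n)) ⟩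
  (isFree x + free xs) + (sum (map (λ j → consumedBy j x) (seq 0 n)) + sum (map (λ j → uses# j xs) (seq 0 n)))
    ≡⟨ shuffle (isFree x) (free xs) _ _ ⟩
  (isFree x + sum (map (λ j → consumedBy j x) (seq 0 n))) + (free xs + sum (map (λ j → uses# j xs) (seq 0 n)))
    ≡⟨ cong₂ _+_ (one c v) (free-uses n xs vs) ⟩
  suc (length xs) ∎
  where
  open ≡-Reasoning
  shuffle : ∀ a b c d → (a + b) + (c + d) ≡ (a + c) + (b + d)
  shuffle = solve-∀
  one : ∀ c → Valid n (b , c) → isFree (b , c) + sum (map (λ j → consumedBy j (b , c)) (seq 0 n)) ≡ 1
  one nothing _ = cong suc (sum-zeros (λ j → consumedBy j (b , nothing)) (seq 0 n) (λ _ → refl))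
  one (just j) v = count-seq j 0 n {b} z≤n (proj₂ (v j refl))

sum-at : {A : Set} (g : A → ℕ) (f : ℕ → ℕ) (i : ℕ) (σ : List A) → (∀ {j t} → At σ j t → f (i + j) ≡ g t) →
  sum (map f (seq i (length σ))) ≡ sum (map g σ)
sum-at g f i [] e = refl
sum-at g f i (t ∷ σ) e = cong₂ _+_ (trans (cong f (sym (+-identityʳ i))) (e here))
  (sum-at g f (suc i) σ λ {j} a → trans (cong f (sym (+-suc i j))) (e (there a)))

-- Birth `suc m` means made at position `m`: no token passes from position `m` to the next one. So
-- the two transitions there are not causally ordered.
Apart : ℕ → List Token → Set
Apart m = All (λ (b , c) → ¬ (b ≡ suc m × c ≡ just (suc m)))

module Extensions (N : Net) where
  open Net N
  open Firing N
  open Prefixes N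
  open Schedules N

  extends-≤P : ∀ {σ τ r r′} (sch : Schedule σ r) (sch′ : Schedule (σ ++ τ) r′) →
    (∀ s → Extends (length σ) (r s) (r′ s)) → _≤P_ N (canonical σ r sch) (canonical (σ ++ τ) r′ sch′)
  extends-≤P {σ} {τ} {r} {r′} sch sch′ ext = record
    { ιS = λ (s , k) → s , extends-index (ext s) k
    ; ιT = inject++ σ
    ; ιS-inj = λ { {s , k} {s′ , l} e → inj s s′ k l e }
    ; ιT-inj = λ {k} {l} e → toℕ-injective (trans (sym (toℕ-inject++ σ k)) (trans (cong toℕ e) (toℕ-inject++ σ l)))
    ; m0-eq = λ (s , k) → cong (λ b → indicator (b ≟ 0)) (proj₁ (extends-same (ext s) k))
    ; m0-sub = λ (s , k) a → let (l , e) = extends-initial (ext s) k (indicator⁻ (proj₁ (lookup (r′ s) k) ≟ 0) a)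
                             in (s , l) , cong (s ,_) e
    ; pre-eq = λ (s , k) i → trans (proj₂ (extends-same (ext s) k) (toℕ i) (toℕ<n i))
        (cong (λ j → consumedBy j (lookup (r′ s) (extends-index (ext s) k))) (sym (toℕ-inject++ σ i)))
    ; post-eq = λ i (s , k) → cong₂ (λ b j → indicator (b ≟ suc j)) (proj₁ (extends-same (ext s) k)) (sym (toℕ-inject++ σ i))
    ; πS-eq = λ _ → refl
    ; πT-eq = lookup-inject++ σ
    }
    where
    inj : ∀ s s′ k l → _≡_ {A = Place (σ ++ τ) r′} (s , extends-index (ext s) k) (s′ , extends-index (ext s′) l) →
      _≡_ {A = Place σ r} (s , k) (s′ , l)
    inj s s′ k l e with cong proj₁ e
    ... | refl = cong (s ,_) (extends-injective (ext s) (second-injective e))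

  length-births : ∀ i s σ → length (births i s σ) ≡ produced s σ
  length-births i s [] = refl
  length-births i s (t ∷ σ) = trans (length-++ (replicate (post t s) (suc i)))
    (cong₂ _+_ (length-replicate (post t s)) (length-births (suc i) s σ))

  length-allBirths : ∀ s σ → length (allBirths s σ) ≡ M0 s + produced s σ
  length-allBirths s σ = trans (length-++ (replicate (M0 s) 0)) (cong₂ _+_ (length-replicate (M0 s)) (length-births 0 s σ))

  births-snoc : ∀ i s σ {t} → births i s (σ ++ t ∷ []) ≡ births i s σ ++ replicate (post t s) (suc (i + length σ))
  births-snoc i s [] = trans (++-identityʳ _) (cong (λ k → replicate _ (suc k)) (sym (+-identityʳ i)))
  births-snoc i s (u ∷ σ) {t} = trans (cong (replicate (post u s) (suc i) ++_)
      (trans (births-snoc (suc i) s σ) (cong (λ k → births (suc i) s σ ++ replicate (post t s) (suc k)) (sym (+-suc i _)))))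
    (sym (++-assoc (replicate (post u s) (suc i)) _ _))

  -- Free tokens and the marking satisfy the same balance: what was created minus what was consumed
  -- along `σ`.
  schedule-free : ∀ {σ r M} → Schedule σ r → Reach N M0 σ M → ∀ s → free (r s) ≡ M s
  schedule-free {σ} {r} {M} sch reach s = +-cancelʳ-≡ (consumed s σ) _ _ (begin
    free (r s) + consumed s σ
      ≡⟨ cong (free (r s) +_) (sum-at (pre s) (λ j → uses# j (r s)) 0 σ (uses s)) ⟨
    free (r s) + sum (map (λ j → uses# j (r s)) (seq 0 (length σ)))
      ≡⟨ free-uses (length σ) (r s) (valid s) ⟩
    length (r s)               ≡⟨ length-map proj₁ (r s) ⟨
    length (map proj₁ (r s))   ≡⟨ cong length (born s) ⟩
    length (allBirths s σ)     ≡⟨ length-allBirths s σ ⟩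
    M0 s + produced s σ        ≡⟨ reach-balance reach s ⟨
    M s + consumed s σ         ∎)
    where
    open Schedule sch
    open ≡-Reasoning

  extendRows : List T → T → Rows → Rows
  extendRows σ t r s = claim (pre s t) (length σ) (r s) ++ replicate (post t s) (suc (length σ) , nothing)

  token-births : ∀ {σ r} → Schedule σ r → ∀ s → All (λ x → proj₁ x ≤ length σ) (r s)
  token-births {σ} sch s = All.tabulate λ m → allBirths-range s σ (subst (_ ∈_) (Schedule.born sch s) (∈-map⁺ proj₁ m))

  length-snoc : ∀ (σ : List T) {t} → length (σ ++ t ∷ []) ≡ suc (length σ)
  length-snoc [] = refl
  length-snoc (_ ∷ σ) = cong suc (length-snoc σ)

  extend : ∀ {σ r t} → Schedule σ r → (∀ s → pre s t ≤ free (r s)) → Schedule (σ ++ t ∷ []) (extendRows σ t r)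
  extend {σ} {r} {t} sch enough = record { born = born′ ; uses = uses′ ; valid = valid′ }
    where
    open Schedule sch
    n = length σ
    fresh : S → List Token
    fresh s = replicate (post t s) (suc n , nothing)
    born′ : ∀ s → map proj₁ (extendRows σ t r s) ≡ allBirths s (σ ++ t ∷ [])
    born′ s = begin
      map proj₁ (claim (pre s t) n (r s) ++ fresh s)                  ≡⟨ map-++ proj₁ (claim (pre s t) n (r s)) _ ⟩
      map proj₁ (claim (pre s t) n (r s)) ++ map proj₁ (fresh s)
        ≡⟨ cong₂ _++_ (trans (claim-born (pre s t) n (r s)) (born s)) (map-replicate proj₁ (post t s) _) ⟩
      allBirths s σ ++ replicate (post t s) (suc n)                   ≡⟨ ++-assoc (replicate (M0 s) 0) _ _ ⟩
      replicate (M0 s) 0 ++ births 0 s σ ++ replicate (post t s) (suc n) ≡⟨ cong (replicate (M0 s) 0 ++_) (births-snoc 0 s σ) ⟨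
      allBirths s (σ ++ t ∷ [])                                       ∎
      where open ≡-Reasoning
    uses-fresh : ∀ s j → uses# j (extendRows σ t r s) ≡ uses# j (claim (pre s t) n (r s))
    uses-fresh s j = trans (cong sum (map-++ (consumedBy j) (claim (pre s t) n (r s)) _))
      (trans (sum-++ (map (consumedBy j) (claim (pre s t) n (r s))) _)
        (trans (cong (uses# j (claim (pre s t) n (r s)) +_) (sum-zeros (consumedBy j) (fresh s) λ m →
          cong (consumedBy j) (∈-replicate⁻ (post t s) m))) (+-identityʳ _)))
    uses′ : ∀ s {j u} → At (σ ++ t ∷ []) j u → uses# j (extendRows σ t r s) ≡ pre s u
    uses′ s {j} at with at-snoc σ at
    ... | inj₁ a = trans (uses-fresh s j) (trans (claim-old (pre s t) (r s) (<⇒≢ (at-< a))) (uses s a))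
    ... | inj₂ (refl , refl) = trans (uses-fresh s n) (trans (claim-new (pre s t) n (r s) (enough s))
      (trans (cong (pre s t +_) (sum-zeros (consumedBy n) (r s) λ {x} m → indicator-no (≡-dec _≟_ (proj₂ x) (just n))
        λ e → <-irrefl refl (proj₂ (All.lookup (valid s) m n e)))) (+-identityʳ _)))
    valid′ : ∀ s → All (Valid (length (σ ++ t ∷ []))) (extendRows σ t r s)
    valid′ s rewrite length-snoc σ {t} = All.++⁺
      (claim-All {Q = λ x → Valid n x × proj₁ x ≤ n} (pre s t) (r s)
        (λ { (_ , le) j refl → le , ≤-refl })
        (λ { (v , _) j e → proj₁ (v j e) , m<n⇒m<1+n (proj₂ (v j e)) })
        (All.zip (valid s , token-births sch s)))
      (All.replicate⁺ (post t s) λ j ())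

  extend-≤P : ∀ {σ r t} (sch : Schedule σ r) (enough : ∀ s → pre s t ≤ free (r s)) →
    _≤P_ N (canonical σ r sch) (canonical (σ ++ t ∷ []) (extendRows σ t r) (extend sch enough))
  extend-≤P {σ} {r} {t} sch enough = extends-≤P sch (extend sch enough) λ s →
    claim-extends (pre s t) (r s) (All.replicate⁺ (post t s) λ ())

  -- New claims name the position `length σ`, which is beyond `suc m`, and new tokens are free;
  -- neither produces the forbidden pair.
  extend-apart : ∀ {σ r t m} s → suc m < length σ → Apart m (r s) → Apart m (extendRows σ t r s)
  extend-apart {σ} {r} {t} s lt ap = All.++⁺
    (claim-All (pre s t) (r s) (λ { _ (_ , e) → <-irrefl (sym (just-injective e)) lt }) id ap)
    (All.replicate⁺ (post t s) λ { (_ , ()) })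

  record Extension {σ r} (sch : Schedule σ r) (ω : List T) : Set₁ where
    field
      rows′  : Rows
      sch′   : Schedule ω rows′
      prefix : _≤P_ N (canonical σ r sch) (canonical ω rows′ sch′)
      apart  : ∀ {m} s → suc m < length σ → Apart m (r s) → Apart m (rows′ s)

  extension : ∀ {σ r} τ (sch : Schedule σ r) → FS N (σ ++ τ) → Extension sch (σ ++ τ)
  extension {σ} {r} [] sch fs = subst (Extension sch) (sym (++-identityʳ σ)) (record
    { sch′ = sch ; apart = λ _ _ → id
    ; prefix = record { ιS = id ; ιT = id ; ιS-inj = id ; ιT-inj = id ; m0-eq = λ _ → refl ; m0-sub = λ s _ → s , refl
                      ; pre-eq = λ _ _ → refl ; post-eq = λ _ _ → refl ; πS-eq = λ _ → refl ; πT-eq = λ _ → refl } })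
  extension {σ} {r} (t ∷ τ) sch fs = subst (Extension sch) (++-assoc σ (t ∷ []) τ) (record
    { sch′ = E.sch′
    ; prefix = ≤P-trans (extend-≤P sch enough) E.prefix
    ; apart = λ s lt → E.apart s (subst (_ <_) (sym (length-snoc σ)) (m<n⇒m<1+n lt)) ∘ extend-apart {σ} {r} s lt
    })
    where
    enough : ∀ s → pre s t ≤ free (r s)
    enough s with reach-split σ (proj₂ fs)
    ... | M , reach , step (en , _) _ = subst (pre s t ≤_) (sym (schedule-free sch reach s)) (en s)
    module E = Extension (extension τ (extend sch enough) (subst (FS N) (sym (++-assoc σ (t ∷ []) τ)) fs))

  initialSchedule : Schedule [] (λ s → replicate (M0 s) (0 , nothing))
  initialSchedule = record
    { born = λ s → trans (map-replicate proj₁ (M0 s) _) (sym (++-identityʳ _))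
    ; uses = λ s ()
    ; valid = λ s → All.replicate⁺ (M0 s) λ j () }

  -- When t and u are enabled together, u can claim tokens that exist before t.
  apart-schedule : ∀ {σ₁ t u σ₂ M} → FS N (σ₁ ++ t ∷ u ∷ σ₂) → Reach N M0 σ₁ M → Enabled2 N M t u →
    ∃ λ r → Schedule (σ₁ ++ t ∷ u ∷ σ₂) r × (∀ s → Apart (length σ₁) (r s))
  apart-schedule {σ₁} {t} {u} {σ₂} {M} fs reach en =
    subst (λ ω → ∃ λ r → Schedule ω r × (∀ s → Apart m (r s)))
      (trans (++-assoc (σ₁ ++ t ∷ []) (u ∷ []) σ₂) (++-assoc σ₁ (t ∷ []) (u ∷ σ₂)))
      (E₃.rows′ , E₃.sch′ , λ s → E₃.apart s
        (subst (suc m <_) (sym (trans (length-snoc (σ₁ ++ t ∷ [])) (cong suc (length-snoc σ₁)))) ≤-refl) (apart₂ s))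
    where
    m = length σ₁
    module E = Extension (extension σ₁ initialSchedule (_ , reach))
    r = E.rows′
    frees : ∀ s → pre s t + pre s u ≤ free (r s)
    frees s = subst (pre s t + pre s u ≤_) (sym (schedule-free E.sch′ reach s)) (en s)
    sch₁ = extend E.sch′ (λ s → ≤-trans (m≤m+n (pre s t) (pre s u)) (frees s))
    r₁ = extendRows σ₁ t r
    remaining : ∀ s → pre s u ≤ free (claim (pre s t) m (r s))
    remaining s = +-cancelˡ-≤ (pre s t) _ _ (subst (pre s t + pre s u ≤_)
      (sym (claim-free (pre s t) m (r s) (≤-trans (m≤m+n (pre s t) (pre s u)) (frees s)))) (frees s))
    enough : ∀ s → pre s u ≤ free (r₁ s)
    enough s = ≤-trans (remaining s) (subst (free (claim (pre s t) m (r s)) ≤_)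
      (sym (trans (cong sum (map-++ isFree (claim (pre s t) m (r s)) _)) (sum-++ (map isFree (claim (pre s t) m (r s))) _)))
      (m≤m+n _ _))
    sch₂ = extend sch₁ enough
    r₂ = extendRows (σ₁ ++ t ∷ []) u r₁
    apart₂ : ∀ s → Apart m (r₂ s)
    -- Tokens older than `t` have birth at most `m`; those made by `t` are left free, since the
    -- older ones suffice for `u`; those made by `u` are free too.
    apart₂ s = All.++⁺
      (subst (Apart m) (sym (claim-++ (pre s u) _ (claim (pre s t) m (r s)) _ (remaining s)))
        (All.++⁺ (All.map (λ le → λ { (refl , _) → <-irrefl refl le })
                   (claim-All {Q = λ x → proj₁ x ≤ m} {Q′ = λ x → proj₁ x ≤ m} (pre s u) (claim (pre s t) m (r s)) id id
                     (claim-All (pre s t) (r s) id id (token-births E.sch′ s))))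
                 (All.replicate⁺ (post t s) λ { (_ , ()) })))
      (All.replicate⁺ (post u s) λ { (_ , ()) })
    module E₃ = Extension (extension σ₂ sch₂ (subst (FS N)
      (sym (trans (++-assoc (σ₁ ++ t ∷ []) (u ∷ []) σ₂) (++-assoc σ₁ (t ∷ []) (u ∷ σ₂)))) fs))

-- Sorting consumers by swaps

-- A free token is treated as consumed at infinity, so sorting moves free tokens to the end.
_≤⁺_ : Maybe ℕ → Maybe ℕ → Set
_≤⁺_ = Supremum._≤⁺_ _≤_

_≤⁺?_ : ∀ c d → Dec (c ≤⁺ d)
_≤⁺?_ = Supremum.≤⁺-dec _≤_ _≤?_

data Exchange : List Token → List Token → Set where
  here  : ∀ {b c b′ c′ xs} → Exchange ((b , c) ∷ (b′ , c′) ∷ xs) ((b , c′) ∷ (b′ , c) ∷ xs)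
  there : ∀ {x xs ys} → Exchange xs ys → Exchange (x ∷ xs) (x ∷ ys)

exchange-sym : ∀ {xs ys} → Exchange xs ys → Exchange ys xs
exchange-sym here = here
exchange-sym (there e) = there (exchange-sym e)

exchange-born : ∀ {xs ys} → Exchange xs ys → map proj₁ xs ≡ map proj₁ ys
exchange-born here = refl
exchange-born (there {x} e) = cong (proj₁ x ∷_) (exchange-born e)

exchange-uses : ∀ {xs ys} j → Exchange xs ys → uses# j xs ≡ uses# j ys
exchange-uses j (here {b} {c} {b′} {c′}) = shuffle (consumedBy j (b , c)) (consumedBy j (b′ , c′)) _
  where
  shuffle : ∀ a b c → a + (b + c) ≡ b + (a + c)
  shuffle = solve-∀
exchange-uses j (there {x} e) = cong (consumedBy j x +_) (exchange-uses j e)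

exchange-All : ∀ {Q : Maybe ℕ → Set} {xs ys} → Exchange xs ys → All Q (map proj₂ xs) → All Q (map proj₂ ys)
exchange-All here (p ∷ q ∷ ps) = q ∷ p ∷ ps
exchange-All (there e) (p ∷ ps) = p ∷ exchange-All e ps

left right : ∀ {xs ys} → Exchange xs ys → Fin (length xs)
left here       = Fin.zero
left (there e)  = Fin.suc (left e)
right here      = Fin.suc Fin.zero
right (there e) = Fin.suc (right e)

lookup-cast : {A : Set} {xs ys : List A} (eq : length xs ≡ length ys) → xs ≡ ys → ∀ k → lookup ys (cast eq k) ≡ lookup xs k
lookup-cast {xs = xs} eq refl k = cong (lookup xs) (Fin.cast-is-id eq k)

lookup-map-cast : {A B : Set} (f : A → B) {xs ys : List A} (eq : length xs ≡ length ys) → map f xs ≡ map f ys →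
  ∀ k → f (lookup ys (cast eq k)) ≡ f (lookup xs k)
lookup-map-cast f {x ∷ xs} {y ∷ ys} eq e Fin.zero = sym (proj₁ (∷-injective e))
lookup-map-cast f {x ∷ xs} {y ∷ ys} eq e (Fin.suc k) = lookup-map-cast f (suc-injective eq) (proj₂ (∷-injective e)) k

exchange-left : ∀ {xs ys} (e : Exchange xs ys) (eq : length xs ≡ length ys) →
  proj₂ (lookup ys (cast eq (left e))) ≡ proj₂ (lookup xs (right e))
exchange-left here eq = refl
exchange-left (there e) eq = exchange-left e (suc-injective eq)

exchange-right : ∀ {xs ys} (e : Exchange xs ys) (eq : length xs ≡ length ys) →
  proj₂ (lookup ys (cast eq (right e))) ≡ proj₂ (lookup xs (left e))
exchange-right here eq = refl
exchange-right (there e) eq = exchange-right e (suc-injective eq)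

exchange-other : ∀ {xs ys} (e : Exchange xs ys) (eq : length xs ≡ length ys) k → k ≢ left e → k ≢ right e →
  proj₂ (lookup ys (cast eq k)) ≡ proj₂ (lookup xs k)
exchange-other here eq Fin.zero nl nr = ⊥-elim (nl refl)
exchange-other here eq (Fin.suc Fin.zero) nl nr = ⊥-elim (nr refl)
exchange-other (here {xs = xs}) eq (Fin.suc (Fin.suc k)) nl nr =
  cong proj₂ (lookup-cast {xs = xs} (suc-injective (suc-injective eq)) refl k)
exchange-other (there e) eq Fin.zero nl nr = refl
exchange-other (there e) eq (Fin.suc k) nl nr =
  exchange-other e (suc-injective eq) k (nl ∘ cong Fin.suc) (nr ∘ cong Fin.suc)

Increasing : List Token → Set
Increasing xs = AllPairs _≤⁺_ (map proj₂ xs)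

-- Validity of the result is carried along because each intermediate stage of the sorting has to be
-- a process.
ValidExchange : ℕ → List Token → List Token → Set
ValidExchange n xs ys = Exchange xs ys × All (Valid n) ys

private
  star-cons : ∀ {n x xs ys} → Valid n x → Star (ValidExchange n) xs ys → Star (ValidExchange n) (x ∷ xs) (x ∷ ys)
  star-cons {x = x} v = Star.gmap (x ∷_) (λ (e , vs) → there e , v ∷ vs)

  star-All : ∀ {Q : Maybe ℕ → Set} {n xs ys} → Star (ValidExchange n) xs ys → All Q (map proj₂ xs) → All Q (map proj₂ ys)
  star-All ε q = q
  star-All ((e , _) ◅ es) q = star-All es (exchange-All e q)

  star-valid : ∀ {n xs ys} → Star (ValidExchange n) xs ys → All (Valid n) xs → All (Valid n) ys
  star-valid ε v = v
  star-valid ((_ , v) ◅ es) _ = star-valid es v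

  star-born : ∀ {n xs ys} → Star (ValidExchange n) xs ys → map proj₁ xs ≡ map proj₁ ys
  star-born ε = refl
  star-born ((e , _) ◅ es) = trans (exchange-born e) (star-born es)

  postpone : ∀ {n b b′ c c′} → c′ ≤⁺ c → Valid n (b , c) → Valid n (b′ , c′) → Valid n (b′ , c)
  postpone Supremum.[ le ] v v′ j refl = ≤-trans (proj₁ (v′ _ refl)) le , proj₂ (v j refl)

  -- For a pair out of order, `b ≤ b′ ≤ c′ ≤ c`. Hence after the exchange both tokens are still
  -- consumed after they are made, and the step is legitimate.
  insert : ∀ {n b c} xs → All (Valid n) ((b , c) ∷ xs) → AllPairs _≤_ (b ∷ map proj₁ xs) → Increasing xs →
    ∃ λ ys → Star (ValidExchange n) ((b , c) ∷ xs) ys × Increasing ys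
  insert {n} {b} {c} [] _ _ _ = (b , c) ∷ [] , ε , [] ∷ []
  insert {n} {b} {c} ((b′ , c′) ∷ xs) (v ∷ v′ ∷ vs) ((b≤b′ ∷ b≤) ∷ b′≤ ∷ bs) (c′≤ ∷ inc) with c ≤⁺? c′
  ... | yes c≤c′ = _ , ε , (c≤c′ ∷ All.map (Supremum.≤⁺-trans _≤_ ≤-trans c≤c′) c′≤) ∷ c′≤ ∷ inc
  ... | no c≰c′ =
    let (ys , star , inc′) = insert xs (later ∷ vs) (b′≤ ∷ bs) inc
    in (b , c′) ∷ ys , (here , earlier ∷ later ∷ vs) ◅ star-cons earlier star , star-All star (c′≤c ∷ c′≤) ∷ inc′
    where
    c′≤c : c′ ≤⁺ c
    c′≤c = [ (λ le → ⊥-elim (c≰c′ le)) , id ]′ (Supremum.≤⁺-total _≤_ ≤-total c c′)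
    earlier : Valid n (b , c′)
    earlier j e = ≤-trans b≤b′ (proj₁ (v′ j e)) , proj₂ (v′ j e)
    later : Valid n (b′ , c)
    later = postpone c′≤c v v′

sortTokens : ∀ {n} xs → All (Valid n) xs → AllPairs _≤_ (map proj₁ xs) →
  ∃ λ ys → Star (ValidExchange n) xs ys × Increasing ys
sortTokens [] _ _ = [] , ε , []
sortTokens {n} ((b , c) ∷ xs) (v ∷ vs) (b≤ ∷ bs) with sortTokens xs vs bs
... | ys , star , inc with insert {n} {b} {c} ys (v ∷ star-valid star vs) (subst (λ l → AllPairs _≤_ (b ∷ l)) (star-born star) (b≤ ∷ bs)) inc
... | zs , star′ , inc′ = zs , star-cons v star ◅◅ star′ , inc′

private
  count : ℕ → List (Maybe ℕ) → ℕ
  count j cs = sum (map (λ c → indicator (≡-dec _≟_ c (just j))) cs)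

  counted : ∀ {j} cs → just j ∈ cs → 1 ≤ count j cs
  counted {j} cs m = subst (_≤ count j cs) (indicator⁺ (≡-dec _≟_ (just j) (just j)) refl)
    (sum-member (λ c → indicator (≡-dec _≟_ c (just j))) m)

  uncounted : ∀ {j} cs → 1 ≤ count j cs → just j ∈ cs
  uncounted {j} cs p with sum-positive (λ c → indicator (≡-dec _≟_ c (just j))) cs p
  ... | c , m , q = subst (_∈ cs) (indicator⁻ (≡-dec _≟_ c (just j)) q) m

  head-≤ : ∀ {c cs d ds j} → AllPairs _≤⁺_ (d ∷ ds) → (∀ j → count j (c ∷ cs) ≡ count j (d ∷ ds)) → c ≡ just j → d ≤⁺ just j
  head-≤ {cs = cs} {d} {ds} {j} (d≤ ∷ _) same refl with uncounted (d ∷ ds) (subst (1 ≤_) (same j) (counted (just j ∷ cs) (here refl)))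
  ... | here refl = Supremum.[ ≤-refl ]
  ... | there m = All.lookup d≤ m

-- The counts do not see `nothing`; the equal lengths account for it. Each head occurs in the other
-- list unless it is `nothing`, so the heads bound each other.
increasing-unique : ∀ cs ds → AllPairs _≤⁺_ cs → AllPairs _≤⁺_ ds → length cs ≡ length ds →
  (∀ j → count j cs ≡ count j ds) → cs ≡ ds
increasing-unique [] [] _ _ _ _ = refl
increasing-unique (c ∷ cs) (d ∷ ds) p@(_ ∷ ps) q@(_ ∷ qs) len same = cong₂ _∷_ c≡d (increasing-unique cs ds ps qs (suc-injective len) same′)
  where
  heads : ∀ c d → (∀ j → c ≡ just j → d ≤⁺ just j) → (∀ j → d ≡ just j → c ≤⁺ just j) → c ≡ d
  heads nothing  nothing  _ _ = refl
  heads nothing  (just d) _ g with g d refl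
  ... | ()
  heads (just c) nothing  f _ with f c refl
  ... | ()
  heads (just c) (just d) f g = cong just (≤-antisym (Supremum.[≤]-injective _≤_ (g d refl)) (Supremum.[≤]-injective _≤_ (f c refl)))
  c≡d : c ≡ d
  c≡d = heads c d (λ j → head-≤ {cs = cs} q same) (λ j → head-≤ {cs = ds} p (sym ∘ same))
  same′ : ∀ j → count j cs ≡ count j ds
  same′ j = +-cancelˡ-≡ (indicator (≡-dec _≟_ c (just j))) _ _
    (trans (same j) (cong (λ e → indicator (≡-dec _≟_ e (just j)) + count j ds) (sym c≡d)))

zip-injective : ∀ {xs ys : List Token} → map proj₁ xs ≡ map proj₁ ys → map proj₂ xs ≡ map proj₂ ys → xs ≡ ys
zip-injective {[]} {[]} _ _ = refl
zip-injective {x ∷ xs} {y ∷ ys} e e′ = cong₂ _∷_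
  (cong₂ _,_ (proj₁ (∷-injective e)) (proj₁ (∷-injective e′)))
  (zip-injective (proj₂ (∷-injective e)) (proj₂ (∷-injective e′)))

-- Normal forms of schedules with the same word

module Sorting (N : Net) where
  open Net N
  open Firing N
  open Prefixes N
  open Schedules N
  open Extensions N

  births-increasing : ∀ s σ → AllPairs _≤_ (allBirths s σ)
  births-increasing s σ = AllPairs.++⁺ (same 0 (M0 s)) (from 0 σ) (All.replicate⁺ (M0 s) (All.tabulate λ _ → z≤n))
    where
    same : ∀ v k → AllPairs _≤_ (replicate k v)
    same v zero = []
    same v (suc k) = All.replicate⁺ k ≤-refl ∷ same v k
    from : ∀ i σ → AllPairs _≤_ (births i s σ)
    from i [] = []
    from i (t ∷ σ) = AllPairs.++⁺ (same (suc i) (post t s)) (from (suc i) σ)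
      (All.replicate⁺ (post t s) (All.tabulate λ m → <⇒≤ (proj₁ (births-range (suc i) s σ m))))

  module _ {σ : List T} {r r′ : Rows} (sch : Schedule σ r) (sch′ : Schedule σ r′) where
    private
      P = canonical σ r sch
      P′ = canonical σ r′ sch′
      module S′ = Schedule sch′
      module P = ProcData (proj₁ P)
      module P′ = ProcData (proj₁ P′)

    same-born : ∀ s → map proj₁ (r s) ≡ map proj₁ (r′ s)
    same-born s = trans (Schedule.born sch s) (sym (S′.born s))

    same-length : ∀ s → length (r s) ≡ length (r′ s)
    same-length s = trans (sym (length-map proj₁ (r s))) (trans (cong length (same-born s)) (length-map proj₁ (r′ s)))

    recast : Place σ r → Place σ r′
    recast (s , k) = s , cast (same-length s) k

    recast-birth : ∀ p → proj₁ (token σ r′ (recast p)) ≡ proj₁ (token σ r p)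
    recast-birth (s , k) = lookup-map-cast proj₁ (same-length s) (same-born s) k

    module _ {s : S} (exch : Exchange (r s) (r′ s)) (other : ∀ s′ → s′ ≢ s → r s′ ≡ r′ s′) (isolated : ∀ s′ → Dec (s′ ≡ s)) where
      private
        p q : Place σ r
        p = s , left exch
        q = s , right exch

        -- The consumer of x in r consumes y in r′, hence occurs after the birth of y.
        concurrent : ∀ x y → proj₂ (token σ r′ (recast y)) ≡ proj₂ (token σ r x) → ¬ P.Plus (inj₁ x) (inj₁ y)
        concurrent x y e (_∷_ {y = inj₂ i} a path) =
          <⇒≱ (plus-birth σ r sch path) (subst (_≤ toℕ i) (recast-birth y)
            (birth≤consumer σ r′ sch′ {recast y} {i} (subst (λ c → 1 ≤ indicator (≡-dec _≟_ c (just (toℕ i)))) (sym e) a)))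

        unchanged : ∀ x → x ≢ p → x ≢ q → proj₂ (token σ r′ (recast x)) ≡ proj₂ (token σ r x)
        unchanged (s′ , k) np nq with isolated s′
        ... | yes refl = exchange-other exch (same-length s) k (np ∘ cong (s ,_)) (nq ∘ cong (s ,_))
        ... | no s′≢s = cong proj₂ (lookup-cast (same-length s′) (other s′ s′≢s) k)

        recast⁻ : Place σ r′ → Place σ r
        recast⁻ (s′ , k) = s′ , cast (sym (same-length s′)) k

      exchange-≡₁ : _≡₁_ N P P′
      exchange-≡₁ = p , q ,
        concurrent p q (exchange-right exch (same-length s)) , concurrent q p (exchange-left exch (same-length s)) , refl ,
        mk↔ₛ′ recast recast⁻
          (λ (s′ , k) → cong (s′ ,_) (Fin.cast-involutive (same-length s′) (sym (same-length s′)) k))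
          (λ (s′ , k) → cong (s′ ,_) (Fin.cast-involutive (sym (same-length s′)) (same-length s′) k)) ,
        mk↔ₛ′ id id (λ _ → refl) (λ _ → refl) ,
        (λ x → cong (λ b → indicator (b ≟ 0)) (recast-birth x)) ,
        (λ x i → (λ { refl → cong (use i) (exchange-left exch (same-length s)) }) ,
                 (λ { refl → cong (use i) (exchange-right exch (same-length s)) }) ,
                 (λ np nq → cong (use i) (unchanged x np nq))) ,
        (λ i x → cong (λ b → indicator (b ≟ suc (toℕ i))) (recast-birth x)) ,
        (λ x → refl) , (λ i → refl)
        where
        use : Fin (length σ) → Maybe ℕ → ℕ
        use i c = indicator (≡-dec _≟_ c (just (toℕ i)))

    module _ (same : ∀ s → r s ≡ r′ s) where
      private
        same-token : ∀ p → token σ r p ≡ token σ r′ (recast p)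
        same-token (s , k) = sym (lookup-cast (same-length s) (same s) k)

      recast-onto : ∀ p → ∃ λ p′ → recast p′ ≡ p
      recast-onto (s , k) = (s , cast (sym (same-length s)) k) , cong (s ,_) (Fin.cast-involutive (same-length s) (sym (same-length s)) k)

      -- Rows that agree pointwise need not be equal as functions, so the two processes are
      -- identified only up to isomorphism.
      same-≤P : _≤P_ N P P′
      same-≤P = record
        { ιS = recast ; ιT = id ; ιS-inj = λ {x} {y} → inj x y ; ιT-inj = id
        ; m0-eq = λ p → cong (bornAt 0) (same-token p)
        ; m0-sub = λ p _ → recast-onto p
        ; pre-eq = λ p i → cong (consumedBy (toℕ i)) (same-token p)
        ; post-eq = λ i p → cong (bornAt (suc (toℕ i))) (same-token p)
        ; πS-eq = λ _ → refl ; πT-eq = λ _ → refl }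
        where
        inj : ∀ x y → recast x ≡ recast y → x ≡ y
        inj (s , k) (s′ , l) e with cong proj₁ e
        ... | refl = cong (s ,_) (toℕ-injective (trans (sym (Fin.toℕ-cast (same-length s) k))
          (trans (cong toℕ (second-injective e)) (Fin.toℕ-cast (same-length s) l))))

      same-≡₁ : Place σ r′ → _≡₁_ N P′ P
      same-≡₁ = ≤P-surj⇒≡₁ same-≤P recast-onto (λ i → i , refl)

  -- What it takes to change the row of `s` and leave all other rows alone.
  Isolated : S → Set
  Isolated s = ∀ s′ → Dec (s′ ≡ s)

  -- Every exchange is undone by the reverse exchange. Recording both directions makes it possible
  -- to leave one schedule for its sorted form and return to another.
  record Chained {σ r} (sch : Schedule σ r) (Q : Rows → Set) : Set₁ where
    field
      {rows′} : Rows
      sch′    : Schedule σ rows′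
      forth   : _≡₁*_ N (canonical σ r sch) (canonical σ rows′ sch′)
      back    : _≡₁*_ N (canonical σ rows′ sch′) (canonical σ r sch)
      holds   : Q rows′

  module _ {σ : List T} {s : S} (isolated : Isolated s) where
    private
      update : Rows → List Token → Rows
      update r ys s′ with isolated s′
      ... | yes _ = ys
      ... | no _  = r s′

      update-at : ∀ r ys → update r ys s ≡ ys
      update-at r ys with isolated s
      ... | yes _ = refl
      ... | no n  = ⊥-elim (n refl)

      update-other : ∀ r ys s′ → s′ ≢ s → r s′ ≡ update r ys s′
      update-other r ys s′ n with isolated s′
      ... | yes e = ⊥-elim (n e)
      ... | no _  = refl

      update-schedule : ∀ {r ys} → Schedule σ r → ValidExchange (length σ) (r s) ys → Schedule σ (update r ys)
      update-schedule {r} {ys} sch (exch , v) = record { born = born′ ; uses = uses′ ; valid = valid′ }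
        where
        open Schedule sch
        born′ : ∀ s′ → map proj₁ (update r ys s′) ≡ allBirths s′ σ
        born′ s′ with isolated s′
        ... | yes refl = trans (sym (exchange-born exch)) (born s)
        ... | no _ = born s′
        uses′ : ∀ s′ {j t} → At σ j t → uses# j (update r ys s′) ≡ pre s′ t
        uses′ s′ {j} at with isolated s′
        ... | yes refl = trans (sym (exchange-uses j exch)) (uses s at)
        ... | no _ = uses s′ at
        valid′ : ∀ s′ → All (Valid (length σ)) (update r ys s′)
        valid′ s′ with isolated s′
        ... | yes refl = v
        ... | no _ = valid s′

    star-chained : ∀ {r xs ys} (sch : Schedule σ r) → Star (ValidExchange (length σ)) xs ys → r s ≡ xs →
      Chained sch (λ r′ → r′ s ≡ ys × (∀ s′ → s′ ≢ s → r s′ ≡ r′ s′))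
    star-chained sch ε e = record { sch′ = sch ; forth = ε ; back = ε ; holds = e , λ _ _ → refl }
    star-chained {r} sch (_◅_ {j = zs} (exch , v) es) refl = record
      { sch′ = C.sch′
      ; forth = exchange-≡₁ sch sch₁ exch₁ (update-other r zs) isolated ◅ C.forth
      ; back = C.back ◅◅ exchange-≡₁ sch₁ sch (exchange-sym exch₁) (λ s′ n → sym (update-other r zs s′ n)) isolated ◅ ε
      ; holds = proj₁ C.holds , λ s′ n → trans (update-other r zs s′ n) (proj₂ C.holds s′ n)
      }
      where
      sch₁ = update-schedule sch (exch , v)
      exch₁ : Exchange (r s) (update r zs s)
      exch₁ = subst (Exchange (r s)) (sym (update-at r zs)) exch
      module C = Chained (star-chained sch₁ es (update-at r zs))

  sort-labels : ∀ {σ r} (ls : List (∃ Isolated)) (sch : Schedule σ r) →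
    Chained sch (λ r′ → ∀ s → s ∈ map proj₁ ls → Increasing (r′ s))
  sort-labels [] sch = record { sch′ = sch ; forth = ε ; back = ε ; holds = λ _ () }
  sort-labels {σ} ((s , isolated) ∷ ls) sch = record
    { sch′ = D.sch′ ; forth = C.forth ◅◅ D.forth ; back = D.back ◅◅ C.back ; holds = holds′ }
    where
    module C = Chained (sort-labels ls sch)
    sorted = sortTokens (C.rows′ s) (Schedule.valid C.sch′ s)
      (subst (AllPairs _≤_) (sym (Schedule.born C.sch′ s)) (births-increasing s σ))
    module D = Chained (star-chained isolated C.sch′ (proj₁ (proj₂ sorted)) refl)
    holds′ : ∀ s′ → s′ ∈ s ∷ map proj₁ ls → Increasing (D.rows′ s′)
    holds′ s′ m with isolated s′
    holds′ s′ m | yes refl = subst Increasing (sym (proj₁ D.holds)) (proj₂ (proj₂ sorted))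
    holds′ s′ (here e) | no n = ⊥-elim (n e)
    holds′ s′ (there m) | no n = subst Increasing (proj₂ D.holds s′ n) (C.holds s′ m)

  -- Equality on S is not decidable in general, but the enumeration of a preset separates its elements.
  input-isolated : ∀ {s t} → 1 ≤ pre s t → Isolated s
  input-isolated {s} {t} a s′ with zero⊎pos (pre s′ t)
  ... | inj₁ e = no λ { refl → <-irrefl (sym e) a }
  ... | inj₂ a′ with Any.index (proj₂ (preFin t) s′ a′) Fin.≟ Any.index (proj₂ (preFin t) s a)
  ... | yes e = yes (trans (Any.lookup-index (proj₂ (preFin t) s′ a′))
      (trans (cong (lookup (proj₁ (preFin t))) e) (sym (Any.lookup-index (proj₂ (preFin t) s a)))))
  -- The index could depend on the proof of positivity; `≤-irrelevant` identifies the two proofs.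
  ... | no n = no λ { refl → n (cong (λ b → Any.index (proj₂ (preFin t) s b)) (≤-irrelevant a′ a)) }

  isolatedInputs : T → List S → List (∃ Isolated)
  isolatedInputs t [] = []
  isolatedInputs t (s ∷ l) with 1 ≤? pre s t
  ... | yes a = (s , input-isolated a) ∷ isolatedInputs t l
  ... | no _  = isolatedInputs t l

  ∈-isolatedInputs : ∀ {t s l} → s ∈ l → 1 ≤ pre s t → s ∈ map proj₁ (isolatedInputs t l)
  ∈-isolatedInputs {t} {s} {s′ ∷ l} m a with 1 ≤? pre s′ t
  ∈-isolatedInputs (here e) a | yes _ = here e
  ∈-isolatedInputs (there m) a | yes _ = there (∈-isolatedInputs m a)
  ∈-isolatedInputs (here refl) a | no n = ⊥-elim (n a)
  ∈-isolatedInputs (there m) a | no _ = ∈-isolatedInputs m a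

  labels : List T → List (∃ Isolated)
  labels []      = []
  labels (t ∷ σ) = isolatedInputs t (proj₁ (preFin t)) ++ labels σ

  ∈-labels : ∀ {σ s t} → t ∈ σ → 1 ≤ pre s t → s ∈ map proj₁ (labels σ)
  ∈-labels {t ∷ σ} {s} (here refl) a = subst (s ∈_) (sym (map-++ proj₁ (isolatedInputs t (proj₁ (preFin t))) _))
    (∈-++⁺ˡ (∈-isolatedInputs (proj₂ (preFin t) s a) a))
  ∈-labels {t ∷ σ} {s} (there m) a = subst (s ∈_) (sym (map-++ proj₁ (isolatedInputs t (proj₁ (preFin t))) _))
    (∈-++⁺ʳ (map proj₁ (isolatedInputs t (proj₁ (preFin t)))) (∈-labels m a))

  -- A row containing a consumed token has its label in the preset of some transition of `σ`, hence
  -- in `labels σ`. Every other row is entirely free and trivially increasing, so finitely many rows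
  -- need sorting.
  increasing-all : ∀ {σ r} → Schedule σ r → (∀ s → s ∈ map proj₁ (labels σ) → Increasing (r s)) → ∀ s → Increasing (r s)
  increasing-all {σ} {r} sch inc s with All.all? (λ x → ≡-dec _≟_ (proj₂ x) nothing) (r s)
  ... | yes none = unused none
    where
    unused : ∀ {xs} → All (λ x → proj₂ x ≡ nothing) xs → Increasing xs
    unused [] = []
    unused (refl ∷ es) = All.map⁺ (All.map (λ { refl → nothing Supremum.≤⊤⁺ }) es) ∷ unused es
  ... | no some with find (All.¬All⇒Any¬ (λ x → ≡-dec _≟_ (proj₂ x) nothing) (r s) some)
  ... | (b , nothing) , _ , n = ⊥-elim (n refl)
  ... | (b , just j) , m , _ with at-any σ (proj₂ (All.lookup (Schedule.valid sch s) m j refl))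
  ... | t , at = inc s (∈-labels (at-∈ at) (subst (1 ≤_) (Schedule.uses sch s at)
    (subst (_≤ uses# j (r s)) (indicator⁺ (≡-dec _≟_ (just j) (just j)) refl) (sum-member (consumedBy j) m))))

  increasing-same : ∀ {σ r r′} → Schedule σ r → Schedule σ r′ → (∀ s → Increasing (r s)) → (∀ s → Increasing (r′ s)) →
    ∀ s → r s ≡ r′ s
  increasing-same {σ} {r} {r′} sch sch′ inc inc′ s = zip-injective (same-born sch sch′ s)
    (increasing-unique _ _ (inc s) (inc′ s)
      (trans (length-map proj₂ (r s)) (trans (same-length sch sch′ s) (sym (length-map proj₂ (r′ s)))))
      λ j → trans (cong sum (sym (map-∘ (r s)))) (trans (counts j) (cong sum (map-∘ (r′ s)))))
    where
    none : ∀ {r j} → Schedule σ r → length σ ≤ j → uses# j (r s) ≡ 0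
    none {r} {j} sch le = sum-zeros (consumedBy j) (r s) λ {x} m → indicator-no (≡-dec _≟_ (proj₂ x) (just j))
      λ e → <⇒≱ (proj₂ (All.lookup (Schedule.valid sch s) m j e)) le
    counts : ∀ j → uses# j (r s) ≡ uses# j (r′ s)
    counts j with j <? length σ
    ... | yes lt = let (t , at) = at-any σ lt in trans (Schedule.uses sch s at) (sym (Schedule.uses sch′ s at))
    ... | no nlt = trans (none sch (≮⇒≥ nlt)) (sym (none sch′ (≮⇒≥ nlt)))

  some-place : ∀ {σ r s} → Schedule σ r → 1 ≤ M0 s → Place σ r
  some-place {σ} {r} {s} sch a = s , fromℕ< (≤-trans a (subst (M0 s ≤_)
    (trans (sym (length-allBirths s σ)) (trans (cong length (sym (Schedule.born sch s))) (length-map proj₁ (r s)))) (m≤m+n (M0 s) _)))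

  -- Both schedules have the same sorted form. The initially marked `s` provides the place for the
  -- trivial swap between its two copies.
  same-word : ∀ {σ r r′ s} (sch : Schedule σ r) (sch′ : Schedule σ r′) → 1 ≤ M0 s →
    _≡₁*_ N (canonical σ r sch) (canonical σ r′ sch′)
  same-word {σ} sch sch′ a = C.forth ◅◅ same-≡₁ C′.sch′ C.sch′
      (increasing-same C′.sch′ C.sch′ (increasing-all C′.sch′ C′.holds) (increasing-all C.sch′ C.holds))
      (some-place C.sch′ a) ◅ C′.back
    where
    module C = Chained (sort-labels (labels σ) sch)
    module C′ = Chained (sort-labels (labels σ) sch′)

-- Both simulations

map-split : {A B : Set} (f : A → B) (xs : List A) (as : List B) {bs : List B} → map f xs ≡ as ++ bs →
  ∃₂ λ ys zs → xs ≡ ys ++ zs × map f ys ≡ as × map f zs ≡ bs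
map-split f xs [] e = [] , xs , refl , refl , e
map-split f (x ∷ xs) (a ∷ as) e with map-split f xs as (proj₂ (∷-injective e))
... | ys , zs , refl , e₁ , e₂ = x ∷ ys , zs , refl , cong₂ _∷_ (proj₁ (∷-injective e)) e₁ , e₂

at-map : {A B : Set} (f : A → B) {xs : List A} {j : ℕ} {x : A} → At xs j x → At (map f xs) j (f x)
at-map f here = here
at-map f (there a) = there (at-map f a)

at-middle : {A : Set} (as : List A) {x : A} {xs : List A} → At (as ++ x ∷ xs) (length as) x
at-middle [] = here
at-middle (_ ∷ as) = there (at-middle as)

at-middle₂ : {A : Set} (as : List A) {x y : A} {xs : List A} → At (as ++ x ∷ y ∷ xs) (suc (length as)) y
at-middle₂ [] = there here
at-middle₂ (_ ∷ as) = there (at-middle₂ as)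

at-seq : ∀ k n {j v} → At (seq k n) j v → v ≡ k + j
at-seq k (suc n) here = sym (+-identityʳ k)
at-seq k (suc n) (there {j = j} a) = trans (at-seq (suc k) n a) (sym (+-suc k j))

map-seq : {A : Set} (f : ℕ → A) (k : ℕ) (xs : List A) → (∀ i → lookup xs i ≡ f (k + toℕ i)) → map f (seq k (length xs)) ≡ xs
map-seq f k [] e = refl
map-seq f k (x ∷ xs) e = cong₂ _∷_ (trans (cong f (sym (+-identityʳ k))) (sym (e Fin.zero)))
  (map-seq f (suc k) xs λ i → trans (e (Fin.suc i)) (cong f (+-suc k (toℕ i))))

lookup-map-seq : {A : Set} (f : ℕ → A) (k n : ℕ) (i : Fin (length (map f (seq k n)))) → lookup (map f (seq k n)) i ≡ f (k + toℕ i)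
lookup-map-seq f k (suc n) Fin.zero = cong f (sym (+-identityʳ k))
lookup-map-seq f k (suc n) (Fin.suc i) = trans (lookup-map-seq f (suc k) n i) (cong f (sym (+-suc k (toℕ i))))

seq-∋ : ∀ k n {v} → k ≤ v → v < k + n → v ∈ seq k n
seq-∋ k zero k≤v v< = ⊥-elim (<⇒≱ v< (subst (_≤ _) (sym (+-identityʳ k)) k≤v))
seq-∋ k (suc n) {v} k≤v v< with m≤n⇒m<n∨m≡n k≤v
... | inj₁ lt = there (seq-∋ (suc k) n lt (subst (v <_) (+-suc k n) v<))
... | inj₂ refl = here refl

choose-preimages : {A B : Set} (f : A → B) (xs : List B) → (∀ {x} → x ∈ xs → ∃ λ a → f a ≡ x) → ∃ λ as → map f as ≡ xs
choose-preimages f [] _ = [] , refl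
choose-preimages f (x ∷ xs) h =
  let (a , e) = h (here refl)
      (as , es) = choose-preimages f xs (h ∘ there)
  in a ∷ as , cong₂ _∷_ e es

module Comparison (N : Net) where
  open Net N
  open Firing N
  open Prefixes N
  open Schedules N
  open Extensions N
  open Sorting N

  -- Unfolding a complete run reaches all transitions and hence all places, so the embedding is onto
  -- and the canonical process of the new word is an isomorphic copy.
  relinearise : ∀ {σ r s ω ts} (sch : Schedule σ r) → 1 ≤ M0 s → CompleteRun (canonical σ r sch) ts → map (lookup σ) ts ≡ ω →
    ∃₂ λ r′ (sch′ : Schedule ω r′) → _≡₁_ N (canonical σ r sch) (canonical ω r′ sch′)
  relinearise {σ} {r} {ts = ts} sch a (run , complete) refl =
    rows run , schedule run , ≤P-surj⇒≡₁ (embedding run)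
      (λ p → embedding-place run (Occurrences.origin P {p} ts λ {i} _ → complete i))
      (λ i → embedding-transition run (complete i)) (some-place sch a)
    where
    P = canonical σ r sch
    open Unfolding N P

  module _ {σ : List T} {r : Rows} (sch : Schedule σ r) where
    private
      P = canonical σ r sch
    open Occurrences P using (Precedes; RunFrom; RSwap; run-swap; swap-∈)

    allFin-position : ∀ {n j} {i : Fin n} → At (allFin n) j i → toℕ i ≡ j
    allFin-position {n} {j} {i} at = at-seq 0 n (subst (λ l → At l j (toℕ i))
      (trans (map-tabulate id toℕ) (tabulate-seq 0 n toℕ λ _ → refl)) (at-map toℕ at))

    swap-run-at : ∀ ys x y zs → allFin _ ≡ ys ++ x ∷ y ∷ zs → (∀ s → Apart (length ys) (r s)) →
      CompleteRun P (ys ++ y ∷ x ∷ zs)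
    swap-run-at ys x y zs e apart =
      run-swap (subst (RunFrom []) e (canonical-run σ r sch)) (swap ys) ,
      λ i → swap-∈ (swap ys) (subst (i ∈_) e (∈-allFin i))
      where
      toℕ-x : toℕ x ≡ length ys
      toℕ-x = allFin-position (subst (λ l → At l (length ys) x) (sym e) (at-middle ys))
      toℕ-y : toℕ y ≡ suc (length ys)
      toℕ-y = allFin-position (subst (λ l → At l (suc (length ys)) y) (sym e) (at-middle₂ ys))
      unordered : ¬ Precedes x y
      unordered (p , c , d) = All.lookup (apart (proj₁ p)) (token∈ σ r sch p)
        (trans (producer σ r sch {p} c) (cong suc toℕ-x) , trans (consumer σ r sch {p} d) (cong just toℕ-y))
      swap : ∀ ys → RSwap (ys ++ x ∷ y ∷ zs) (ys ++ y ∷ x ∷ zs)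
      swap [] = Runs.here unordered
      swap (_ ∷ ys) = Runs.there (swap ys)

  swap-word : ∀ {A B : Set} (f : A → B) ys {x y zs as t u bs} → map f ys ≡ as → map f (x ∷ y ∷ zs) ≡ t ∷ u ∷ bs →
    map f (ys ++ y ∷ x ∷ zs) ≡ as ++ u ∷ t ∷ bs
  swap-word f ys {x} {y} {zs} refl refl = map-++ f ys (y ∷ x ∷ zs)

  module _ {σ : List T} {r : Rows} {s : S} (sch : Schedule σ r) (a : 1 ≤ M0 s) where
    -- Where t and u are concurrent, one process has both firing sequences as linearisations.
    apart-relinearise : ∀ {σ₁ t u σ₂} → σ ≡ σ₁ ++ t ∷ u ∷ σ₂ → (∀ s → Apart (length σ₁) (r s)) →
      ∃₂ λ r′ (sch′ : Schedule (σ₁ ++ u ∷ t ∷ σ₂) r′) → _≡₁_ N (canonical σ r sch) (canonical _ r′ sch′)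
    apart-relinearise {σ₁} {t} {u} {σ₂} e apart =
      from (map-split (lookup σ) (allFin _) σ₁ (trans (canonical-word σ r sch) e))
      where
      from : (∃₂ λ ys zs → allFin _ ≡ ys ++ zs × map (lookup σ) ys ≡ σ₁ × map (lookup σ) zs ≡ t ∷ u ∷ σ₂) →
        ∃₂ λ r′ (sch′ : Schedule (σ₁ ++ u ∷ t ∷ σ₂) r′) → _≡₁_ N (canonical σ r sch) (canonical _ r′ sch′)
      from (ys , x ∷ y ∷ zs , e₀ , e₁ , e₂) = relinearise sch a
        (swap-run-at sch ys x y zs e₀ (subst (λ m → ∀ s → Apart m (r s))
          (sym (trans (sym (length-map (lookup σ) ys)) (cong length e₁))) apart))
        (swap-word (lookup σ) ys e₁ e₂)

  adjacent-canonical : ∀ {σ ρ s r r′} (sch : Schedule σ r) (sch′ : Schedule ρ r′) → 1 ≤ M0 s → Adj N σ ρ →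
    _≡₁*_ N (canonical σ r sch) (canonical ρ r′ sch′)
  adjacent-canonical sch sch′ a (fs , fs′ , σ₁ , t , u , σ₂ , refl , refl , M , reach , en) =
    let (_ , sch₀ , apart) = apart-schedule fs reach en
        (_ , sch₁ , shared) = apart-relinearise sch₀ a {σ₁} refl apart
    in same-word sch sch₀ a ◅◅ shared ◅ same-word sch₁ sch′ a

  FS⇒Schedule : ∀ {σ} → FS N σ → ∃ λ r → Schedule σ r
  FS⇒Schedule {σ} fs = E.rows′ , E.sch′
    where module E = Extension (extension σ initialSchedule fs)

  equivalent-canonical : ∀ {σ ρ s r r′} (sch : Schedule σ r) (sch′ : Schedule ρ r′) → 1 ≤ M0 s → _≡₀*_ N σ ρ →
    _≡₁*_ N (canonical σ r sch) (canonical ρ r′ sch′)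
  equivalent-canonical sch sch′ a ε = same-word sch sch′ a
  equivalent-canonical sch sch′ a (adj@(_ , fs , _) ◅ adjs) =
    let (_ , sch₁) = FS⇒Schedule fs
    in adjacent-canonical sch sch₁ a adj ◅◅ equivalent-canonical sch₁ sch′ a adjs

  star-empty : ∀ {ρ} → _≡₀*_ N [] ρ → ρ ≡ []
  star-empty ε = refl
  star-empty ((_ , _ , [] , _ , _ , _ , () , _) ◅ _)
  star-empty ((_ , _ , _ ∷ _ , _ , _ , _ , () , _) ◅ _)

  Connected : Process N → Process N → Set₁
  Connected P″ Q = Σ (Process N) λ P′ → Σ (Process N) λ Q′ →
    FiniteP N P′ × FiniteP N Q′ × _≤P_ N P″ P′ × _≡₁*_ N P′ Q′ × _≤P_ N Q′ Q

  -- For the empty word there may be no place at all, and then no swap can identify isomorphic processes.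
  connect : ∀ {P″ Q σ ρ r r′} (sch : Schedule σ r) (sch′ : Schedule ρ r′) → FS N σ → _≡₀*_ N σ ρ →
    _≤P_ N P″ (canonical σ r sch) → _≤P_ N (canonical ρ r′ sch′) Q → Connected P″ Q
  connect {σ = []} {r = r} {r′} sch sch′ _ adjs below above with star-empty adjs
  ... | refl = R , R , canonical-finite [] r′ sch′ , canonical-finite [] r′ sch′ ,
      ≤P-trans below (same-≤P sch sch′ (increasing-same sch sch′ (increasing-all sch λ _ ()) (increasing-all sch′ λ _ ()))) , ε , above
    where R = canonical [] r′ sch′
  connect {σ = σ@(t ∷ _)} {ρ} {r} {r′} sch sch′ (_ , step (en , _) _) adjs below above =
    canonical σ r sch , canonical ρ r′ sch′ , canonical-finite σ r sch , canonical-finite ρ r′ sch′ ,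
    -- The first transition is enabled initially and has a non-empty preset, so some label is marked
    -- by `M0`.
    below , equivalent-canonical sch sch′ (≤-trans (proj₂ (preNE t)) (en _)) adjs , above

  -- A form of compatibility common to finite and infinite words. The rank is the position in `w`;
  -- it makes equality of transitions decidable.
  record Enumeration (P : Process N) (w : Word N) : Set where
    open Occurrences P
    open ProcData (proj₁ P) using (𝒯)
    field
      rank       : 𝒯 → ℕ
      rank-inj   : Injective _≡_ _≡_ rank
      prefix-run-of : ∀ {σ} → _≤w_ N σ w → ∃ λ ts → RunFrom [] ts × word ts ≡ σ
      covering-run  : ∀ l → ∃ λ ts → RunFrom [] ts × l ⊆ ts × _≤w_ N (word ts) w

    equal? : ∀ t u → Dec (t ≡ u)
    equal? t u = map′ rank-inj (cong rank) (rank t ≟ rank u)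

  enumerate : ∀ P w → Compatible N P w → Enumeration P w
  enumerate P (fin σ) (pos , label , mono) = record
    { rank = rank ; rank-inj = rank-inj
    ; prefix-run-of = λ { {τ} (_ , e) → let (ys , _ , e₁ , e₂ , _) = map-split πT all τ (trans word-all (sym e))
                                 in ys , run-++⁻ˡ ys (subst (RunFrom []) e₁ run) , e₂ }
    ; covering-run = λ l → all , run , (λ {t} _ → subst (_∈ all) (I.strictlyInverseʳ t) (∈-map⁺ I.from (∈-allFin (I.to t)))) ,
        [] , trans (++-identityʳ _) word-all
    }
    where
    open ProcData (proj₁ P)
    open Occurrences P
    module I = Inverse pos
    rank = toℕ ∘ I.to
    rank-inj : Injective _≡_ _≡_ rank
    rank-inj {x} {y} e = trans (sym (I.strictlyInverseʳ x)) (trans (cong I.from (toℕ-injective e)) (I.strictlyInverseʳ y))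
    all = map I.from (allFin (length σ))
    run : RunFrom [] all
    run = run-seq rank rank-inj (mono _ _ ∘ precedes⇒plus) 0 (length σ) all
      (trans (sym (map-∘ (allFin _))) (trans (map-cong (λ i → cong toℕ (I.strictlyInverseˡ i)) (allFin _))
        (trans (map-tabulate id toℕ) (tabulate-seq 0 _ _ λ i → refl)))) (λ ()) (λ ())
    word-all : word all ≡ σ
    word-all = trans (sym (map-∘ (allFin _))) (trans (map-cong (λ i → trans (label (I.from i)) (cong (lookup σ) (I.strictlyInverseˡ i))) (allFin _))
      (trans (map-tabulate id (lookup σ)) (tabulate-lookup σ)))
  enumerate P (inf f) (pos , label , mono) = record
    { rank = I.to ; rank-inj = rank-inj
    ; prefix-run-of = λ {σ} e → first (length σ) , run (length σ) , trans (word-first (length σ)) (map-seq f 0 σ e)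
    -- The sum bounds every rank in `l`, and `suc` makes the bound strict.
    ; covering-run = λ l → let n = suc (sum (map I.to l)) in first n , run n ,
        (λ {t} m → subst (_∈ first n) (I.strictlyInverseʳ t) (∈-map⁺ I.from (seq-∋ 0 n z≤n (s≤s (sum-member I.to m))))) ,
        subst (λ ω → _≤w_ N ω (inf f)) (sym (word-first n)) (lookup-map-seq f 0 n)
    }
    where
    open ProcData (proj₁ P)
    open Occurrences P
    module I = Inverse pos
    rank-inj : Injective _≡_ _≡_ I.to
    rank-inj {x} {y} e = trans (sym (I.strictlyInverseʳ x)) (trans (cong I.from e) (I.strictlyInverseʳ y))
    first : ℕ → List 𝒯
    first n = map I.from (seq 0 n)
    run : ∀ n → RunFrom [] (first n)
    run n = run-seq I.to rank-inj (mono _ _ ∘ precedes⇒plus) 0 n (first n)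
      (trans (sym (map-∘ (seq 0 n))) (trans (map-cong I.strictlyInverseˡ (seq 0 n)) (map-id _))) (λ ()) (λ ())
    word-first : ∀ n → word (first n) ≡ map f (seq 0 n)
    word-first n = trans (sym (map-∘ (seq 0 n))) (map-cong (λ i → trans (label (I.from i)) (cong f (I.strictlyInverseˡ i))) (seq 0 n))

  module _ {P Q : Process N} {σ ρ : Word N} (EP : Enumeration P σ) (EQ : Enumeration Q ρ) where
    private
      module P = ProcData (proj₁ P)
      module OP = Occurrences P
      module OQ = Occurrences Q
      module UP = Unfolding N P
      module UQ = Unfolding N Q

    -- The transitions of `P″` occur in some initial run of `σ`, whose process therefore contains
    -- `P″`. The hypothesis prolongs the word of this run; its process is prolonged alongside, and
    -- `connect` carries it to a prefix of `Q`.
    words⇒processes : _⊑₀∞_ N σ ρ → _⊑₁∞_ N P Q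
    words⇒processes h P″ finite le with Enumeration.covering-run EP (map (_≤P_.ιT le) (proj₁ finite))
    ... | ts , run , covers , ≤σ with h (OP.word ts) (OP.run-FS run) ≤σ
    ... | _ , _ , fs , _ , (τ , refl) , adjs , ≤ρ with Enumeration.prefix-run-of EQ ≤ρ
    ... | us , run′ , refl =
      connect E.sch′ (UQ.schedule run′) fs adjs (≤P-trans (≤P-factor le (UP.embedding run) places transitions) E.prefix) (UQ.embedding run′)
      where
      module L = _≤P_ le
      module E = Extension (extension τ (UP.schedule run) fs)
      included : ∀ t → L.ιT t ∈ ts
      included t = covers (∈-map⁺ L.ιT (proj₂ finite t tt))
      transitions : ∀ t → ∃ λ i → _≤P_.ιT (UP.embedding run) i ≡ L.ιT t
      transitions t = UP.embedding-transition run (included t)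
      places : ∀ s → ∃ λ p → _≤P_.ιS (UP.embedding run) p ≡ L.ιS s
      places s with place-origin le finite s
      ... | inj₁ i = UP.embedding-place run (inj₁ (subst (1 ≤_) (L.m0-eq s) i))
      ... | inj₂ (t , a) = UP.embedding-place run (inj₂ (L.ιT t , included t , subst (1 ≤_) (L.post-eq t s) a))

    -- A linearisation of `Q′` need not be an initial segment of `ρ`, but `us` is one that covers
    -- it. Swaps bring `us` into the form `as ++ bs` with `as` linearising `Q′`; this part is
    -- transported to `P′`, and `bs` is appended there as well.
    processes⇒words : _⊑₁∞_ N P Q → _⊑₀∞_ N σ ρ
    processes⇒words h σ″ _ ≤σ with Enumeration.prefix-run-of EP ≤σ
    ... | ts , run , refl with h (canonical (OP.word ts) (UP.rows run) (UP.schedule run))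
                                 (canonical-finite (OP.word ts) (UP.rows run) (UP.schedule run)) (UP.embedding run)
    ... | P′ , Q′ , _ , finite , below , swaps , above =
      σ′ , OQ.word us , star-FS (OQ.run-FS run-us) (Star.reverse adj-sym σ′-us) , OQ.run-FS run-us ,
      (OP′.word us′ ++ OQ.word bs , σ″≤σ′) , σ′-us , ≤ρ
      where
      module OP′ = Occurrences P′
      module OQ′ = Occurrences Q′
      module A = _≤P_ above
      image : List (ProcData.𝒯 (proj₁ Q))
      image = map A.ιT (proj₁ finite)

      cover = Enumeration.covering-run EQ image
      us = proj₁ cover
      run-us : OQ.RunFrom [] us
      run-us = proj₁ (proj₂ cover)
      ≤ρ : _≤w_ N (OQ.word us) ρ
      ≤ρ = proj₂ (proj₂ (proj₂ cover))

      parts = OQ.partition (λ x → Any.any? (Enumeration.equal? EQ x) image) OQ.precedes? us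
      as = proj₁ parts
      bs = proj₁ (proj₂ parts)
      star = proj₁ (proj₂ (proj₂ parts))

      -- Prefixes are causally closed, so taking predecessors never leaves `Q′`; hence `as` contains
      -- nothing foreign.
      in-image : ∀ {x} → OQ.Below (_∈ image) x → ∃ λ t → A.ιT t ≡ x
      in-image (Runs.base m) = let (t , _ , e) = ∈-map⁻ A.ιT m in t , sym e
      in-image (Runs.pred x≺y b) with in-image b
      ... | t , refl = let (t′ , e , _) = prefix-closed above finite x≺y in t′ , e

      preimages = choose-preimages A.ιT as (in-image ∘ All.lookup (proj₁ (proj₂ (proj₂ (proj₂ parts)))))
      vs = proj₁ preimages

      run-as : OQ.RunFrom [] as
      run-as = OQ.run-++⁻ˡ as (OQ.run-star run-us star)

      vs-complete : CompleteRun Q′ vs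
      vs-complete = prefix-run⁻ above finite vs (subst (OQ.RunFrom []) (sym (proj₂ preimages)) run-as) , λ t →
        let m = ∈-map⁺ A.ιT (proj₂ finite t tt)
            (t′ , k , e) = ∈-map⁻ A.ιT (subst (A.ιT t ∈_) (sym (proj₂ preimages))
                             (proj₂ (proj₂ (proj₂ (proj₂ parts))) (proj₁ (proj₂ (proj₂ cover)) m) m))
        in subst (_∈ vs) (sym (A.ιT-inj e)) k

      pulled = swaps-run {P′} {Q′} swaps vs-complete
      ws = proj₁ pulled

      steps = map (_≤P_.ιT below) (allFin _)
      run-steps : OP′.RunFrom [] steps
      run-steps = prefix-run below (canonical-finite (OP.word ts) (UP.rows run) (UP.schedule run))
        (canonical-run (OP.word ts) (UP.rows run) (UP.schedule run))
      word-steps : OP′.word steps ≡ OP.word ts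
      word-steps = trans (prefix-word below (canonical-finite (OP.word ts) (UP.rows run) (UP.schedule run)) (allFin _))
        (canonical-word (OP.word ts) (UP.rows run) (UP.schedule run))

      -- The embedded prefix forms a run of `P′`, so its steps can be moved to the front of `ws`;
      -- this makes `σ″` a prefix of `σ′`.
      merged = OP′.merge run-steps (proj₁ (proj₁ (proj₂ pulled))) (λ {x} _ → proj₂ (proj₁ (proj₂ pulled)) x)
      us′ = proj₁ merged

      σ′ : List T
      σ′ = OP′.word (steps ++ us′) ++ OQ.word bs

      σ″≤σ′ : OP.word ts ++ OP′.word us′ ++ OQ.word bs ≡ σ′
      σ″≤σ′ = trans (sym (++-assoc (OP.word ts) _ _))
        (cong (_++ OQ.word bs) (trans (cong (_++ OP′.word us′) (sym word-steps)) (sym (map-++ P′πT steps us′))))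
        where P′πT = ProcData.πT (proj₁ P′)

      us-split : _≡₀*_ N (OQ.word us) (OQ′.word vs ++ OQ.word bs)
      us-split = subst (_≡₀*_ N (OQ.word us))
        (trans (map-++ (ProcData.πT (proj₁ Q)) as bs)
          (cong (_++ OQ.word bs) (trans (cong OQ.word (sym (proj₂ preimages))) (prefix-word above finite vs))))
        (OQ.star-adj run-us star)

      vs-σ′ : _≡₀*_ N (OQ′.word vs) (OP′.word (steps ++ us′))
      vs-σ′ = Star.reverse adj-sym (proj₂ (proj₂ pulled)) ◅◅ OP′.star-adj (proj₁ (proj₁ (proj₂ pulled))) (proj₂ merged)

      σ′-us : _≡₀*_ N σ′ (OQ.word us)
      σ′-us = Star.reverse adj-sym (us-split ◅◅ star-suffix (OQ.word bs) (star-FS (OQ.run-FS run-us) us-split) vs-σ′)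

theorem2 : (N : Net) (σ ρ : Word N) (P Q : Process N) →
    FS∞ N σ → FS∞ N ρ → Lin N P σ → Lin N Q ρ →
    (_⊑₀∞_ N σ ρ) ⇔ (_⊑₁∞_ N P Q)
theorem2 N σ ρ P Q _ _ (_ , compP) (_ , compQ) = mk⇔ (words⇒processes EP EQ) (processes⇒words EP EQ)
  where
  open Comparison N
  EP = enumerate P σ compP
  EQ = enumerate Q ρ compQ
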